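{- Let $p$ be a prime with $p\equiv 7 \pmod 8$. Suppose that $r$ is an integer such that $1\leq r<8p$, $rp\equiv 1\pmod 8$, and $\gcd(r,p)=1$. Then for all integers $n\geq 0$ and $\alpha\geq 0$, $$ped\left(p^{2\alpha+2}n+\frac{r\,p^{2\alpha+1}-1}{8}\right)\equiv 0 \pmod 8.$$
   Context: For an integer $n\ge 0$, $ped(n)$ denotes the number of partitions of $n$ in which the even parts are distinct (odd parts are unrestricted). Its generating function is $$\sum_{n=0}^{\infty}ped(n)q^n=\prod_{m=1}^{\infty}\frac{1-q^{4m}}{1-q^m}.$$ -}

module Defs where

open import Data.Bool using (if_then_else_; true; false; T)
open import Data.Empty using (⊥; ⊥-elim)
open import Data.List using (List; []; _∷_; _++_; map; filter; length)
open import Data.List.Membership.Propositional using (_∈_)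
open import Data.List.Membership.Propositional.Properties
  using (∈-map⁺; ∈-map⁻; ∈-++⁺ˡ; ∈-++⁺ʳ; ∈-++⁻; ∈-filter⁺; ∈-filter⁻)
open import Data.List.Properties using (∷-injectiveʳ)
open import Data.List.Relation.Unary.All using (All; []; _∷_)
open import Data.List.Relation.Unary.Any using (here)
open import Data.List.Relation.Unary.AllPairs using ([]; _∷_)
open import Data.List.Relation.Unary.Linked using (Linked; []; [-]; _∷_)
open import Data.List.Relation.Unary.Unique.Propositional using (Unique)
import Data.List.Relation.Unary.Unique.Propositional.Properties as Unique
open import Data.Nat using (ℕ; zero; suc; _+_; _∸_; _≤_; _<_; _≥_; z≤n; s≤s; _≟_; _≤ᵇ_)
open import Data.Nat.Divisibility using (_∣?_)
open import Data.Nat.ListAction using (sum)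
open import Data.Nat.Properties
open import Data.Product using (_×_; _,_)
open import Data.Sum using (inj₁; inj₂)
open import Data.Unit using (⊤)
open import Relation.Binary.PropositionalEquality
open import Relation.Nullary using (Dec; yes; no)

open import Data.List.Relation.Unary.Unique.DecPropositional _≟_ using (unique?)

record IsPartition (n : ℕ) (xs : List ℕ) : Set where
  constructor mkIsPartition
  field
    positive   : All (0 <_) xs
    decreasing : Linked _≥_ xs
    total      : sum xs ≡ n

EvenPartsDistinct : List ℕ → Set
EvenPartsDistinct xs = Unique (filter (2 ∣?_) xs)

evenPartsDistinct? : ∀ xs → Dec (EvenPartsDistinct xs)
evenPartsDistinct? xs = unique? (filter (2 ∣?_) xs)

-- boxed l k n lists the partitions of n into at most l parts, each at most k.
-- The two summands in the last clause collect the partitions whose largest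
-- part is at most k, and those whose largest part is suc k.
boxed : ℕ → ℕ → ℕ → List (List ℕ)
boxed l       k       zero    = [] ∷ []
boxed zero    k       (suc n) = []
boxed (suc l) zero    (suc n) = []
boxed (suc l) (suc k) (suc n) =
  boxed (suc l) k (suc n) ++
  (if k ≤ᵇ n then map (suc k ∷_) (boxed l (suc k) (n ∸ k)) else [])

-- A partition of n has at most n parts, each at most n.
partitions : ℕ → List (List ℕ)
partitions n = boxed n n n

pedPartitions : ℕ → List (List ℕ)
pedPartitions n = filter evenPartsDistinct? (partitions n)

ped : ℕ → ℕ
ped n = length (pedPartitions n)

-- The remaining lemmas show that pedPartitions n lists each partition of n
-- with distinct even parts exactly once, so that ped n counts them.

-- For decreasing lists: every part is at most k.
AtMost : ℕ → List ℕ → Set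
AtMost k []      = ⊤
AtMost k (x ∷ _) = x ≤ k

private
  atMost-mono : ∀ {j k} → j ≤ k → ∀ xs → AtMost j xs → AtMost k xs
  atMost-mono j≤k []      _   = _
  atMost-mono j≤k (x ∷ _) x≤j = ≤-trans x≤j j≤k

  cons-decreasing : ∀ {k} xs → AtMost k xs → Linked _≥_ xs → Linked _≥_ (k ∷ xs)
  cons-decreasing []      _   _ = [-]
  cons-decreasing (_ ∷ _) x≤k d = x≤k ∷ d

  tail-decreasing : ∀ {k} xs → Linked _≥_ (k ∷ xs) → AtMost k xs × Linked _≥_ xs
  tail-decreasing []      _         = _ , []
  tail-decreasing (_ ∷ _) (x≤k ∷ d) = x≤k , d

  boxed-sound : ∀ l k n {xs} → xs ∈ boxed l k n → IsPartition n xs × AtMost k xs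
  boxed-sound l k zero (here refl) = mkIsPartition [] [] refl , _
  boxed-sound (suc l) (suc k) (suc n) {xs} m with ∈-++⁻ (boxed (suc l) k (suc n)) m
  ... | inj₁ m₁ with boxed-sound (suc l) k (suc n) m₁
  ...   | p , b = p , atMost-mono (n≤1+n k) xs b
  boxed-sound (suc l) (suc k) (suc n) m | inj₂ m₂ with k ≤ᵇ n in eq
  ... | true with ∈-map⁻ (suc k ∷_) m₂
  ...   | ys , m₃ , refl with boxed-sound l (suc k) (n ∸ k) m₃
  ...     | mkIsPartition p d t , b =
    mkIsPartition (s≤s z≤n ∷ p) (cons-decreasing ys b d)
      (cong suc (trans (cong (k +_) t) (m+[n∸m]≡n k≤n))) , ≤-refl
    where
    k≤n : k ≤ n
    k≤n = ≤ᵇ⇒≤ k n (subst T (sym eq) _)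

  boxed-complete : ∀ l k n xs → length xs ≤ l → AtMost k xs → IsPartition n xs →
                   xs ∈ boxed l k n
  boxed-complete l k zero [] _ _ _ = here refl
  boxed-complete l k zero (suc x ∷ xs) _ _ (mkIsPartition _ _ ())
  boxed-complete l k zero (zero ∷ xs) _ _ (mkIsPartition (() ∷ _) _ _)
  boxed-complete l k (suc n) [] _ _ (mkIsPartition _ _ ())
  boxed-complete (suc l) zero (suc n) (x ∷ xs) _ x≤0 (mkIsPartition (0<x ∷ _) _ _) =
    ⊥-elim (<⇒≱ 0<x x≤0)
  boxed-complete (suc l) (suc k) (suc n) (x ∷ xs) (s≤s len) x≤1+k part with x ≟ suc k
  ... | no x≢1+k =
    ∈-++⁺ˡ (boxed-complete (suc l) k (suc n) (x ∷ xs) (s≤s len)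
             (≤-pred (≤∧≢⇒< x≤1+k x≢1+k)) part)
  boxed-complete (suc l) (suc k) (suc n) (.(suc k) ∷ xs) (s≤s len) _
    (mkIsPartition (_ ∷ p) d t) | yes refl = ∈-++⁺ʳ (boxed (suc l) k (suc n)) rest
    where
    t′ : k + sum xs ≡ n
    t′ = suc-injective t
    rest : suc k ∷ xs ∈
           (if k ≤ᵇ n then map (suc k ∷_) (boxed l (suc k) (n ∸ k)) else [])
    rest with k ≤ᵇ n | ≤⇒≤ᵇ (subst (k ≤_) t′ (m≤m+n k (sum xs))) | tail-decreasing xs d
    ... | true | _ | b , d′ = ∈-map⁺ (suc k ∷_)
      (boxed-complete l (suc k) (n ∸ k) xs len (atMost-mono ≤-refl xs b)
        (mkIsPartition p d′ (trans (sym (m+n∸m≡n k (sum xs))) (cong (_∸ k) t′))))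

  boxed-unique : ∀ l k n → Unique (boxed l k n)
  boxed-unique l       k       zero    = [] ∷ []
  boxed-unique zero    k       (suc n) = []
  boxed-unique (suc l) zero    (suc n) = []
  boxed-unique (suc l) (suc k) (suc n) with k ≤ᵇ n
  ... | false = Unique.++⁺ (boxed-unique (suc l) k (suc n)) [] λ { (_ , ()) }
  ... | true  = Unique.++⁺ (boxed-unique (suc l) k (suc n))
                  (Unique.map⁺ ∷-injectiveʳ (boxed-unique l (suc k) (n ∸ k)))
                  disjoint
    where
    disjoint : ∀ {xs} → xs ∈ boxed (suc l) k (suc n) ×
               xs ∈ map (suc k ∷_) (boxed l (suc k) (n ∸ k)) → ⊥
    disjoint (m₁ , m₂) with ∈-map⁻ (suc k ∷_) m₂
    ... | _ , _ , refl with boxed-sound (suc l) k (suc n) m₁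
    ...   | _ , 1+k≤k = 1+n≰n 1+k≤k

  length≤sum : ∀ {xs} → All (0 <_) xs → length xs ≤ sum xs
  length≤sum []        = z≤n
  length≤sum (0<x ∷ p) = +-mono-≤ 0<x (length≤sum p)

  atMost-sum : ∀ xs → AtMost (sum xs) xs
  atMost-sum []       = _
  atMost-sum (x ∷ xs) = m≤m+n x (sum xs)

pedPartitions-sound : ∀ n {xs} → xs ∈ pedPartitions n →
                      IsPartition n xs × EvenPartsDistinct xs
pedPartitions-sound n m with ∈-filter⁻ evenPartsDistinct? m
... | m′ , e with boxed-sound n n n m′
...   | p , _ = p , e

pedPartitions-complete : ∀ n {xs} → IsPartition n xs → EvenPartsDistinct xs →
                         xs ∈ pedPartitions n
pedPartitions-complete n {xs} part@(mkIsPartition p _ refl) e =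
  ∈-filter⁺ evenPartsDistinct?
    (boxed-complete n n n xs (length≤sum p) (atMost-sum xs) part) e

pedPartitions-unique : ∀ n → Unique (pedPartitions n)
pedPartitions-unique n = Unique.filter⁺ evenPartsDistinct? (boxed-unique n n n)

{-# OPTIONS --safe #-}

-- By Gauss, the generating function F of ped satisfies F φ(−q) = ψ(−q), where
-- φ(−q) = 1 + 2S with S = Σ_{y≥1} (−1)^y q^{y²}, and ψ(−q) = Σ ± q^T over the
-- triangular numbers T.  Hence F ≡ ψ(−q) (1 − 2S + 4S²) (mod 8), and since
-- S² ≡ Σ q^{2y²} (mod 2), ped M vanishes modulo 8 unless 8M + 1 is of the form
-- x² + y² or x² + 2y².  Here p divides 8M + 1 to an exact odd power while −1 and
-- −2 are nonresidues modulo p, so neither form represents it.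
module Submission where

open import Algebra.Bundles using (CommutativeRing)
import Algebra.Properties.Semiring.Exp as Exp
import Algebra.Solver.Ring as RingSolver
open import Algebra.Solver.Ring.AlmostCommutativeRing
  using ( fromCommutativeRing; Induced-equivalence; _-Raw-AlmostCommutative⟶_ )
open import Data.Bool using (if_then_else_; true; false; T)
import Data.Bool.Properties as Bool
open import Data.Fin using (zero; suc)
open import Data.Integer as ℤ using (ℤ; 0ℤ; 1ℤ)
import Data.Integer.Divisibility.Signed as ℤ
import Data.Integer.Properties as ℤ
open import Data.Integer.Solver using () renaming (module +-*-Solver to ℤ-Solver)
open import Data.List using (List; []; _∷_; _++_; map; filter; length)
open import Data.List.Properties
  using ( filter-++; filter-accept; filter-reject; filter-none; filter-≐; length-++;
          ++-identityʳ )
open import Data.List.Relation.Unary.All as All using (All; []; _∷_)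
import Data.List.Relation.Unary.All.Properties as All
open import Data.List.Relation.Unary.AllPairs using (_∷_)
open import Data.List.Relation.Unary.Unique.Propositional using (Unique)
open import Data.Maybe using (just; nothing)
open import Data.Nat using (ℕ; zero; suc; _+_; _*_; _∸_; _^_; _≤_; _<_; z≤n; s≤s; _≤?_; _≤ᵇ_; NonZero)
open import Data.Nat.Coprimality using (Coprime; coprime-Bézout)
open import Data.Nat.DivMod
  using ( _/_; _%_; _divMod_; result; m≡m%n+[m/n]*n; m%n<n; m%n≤m; m*n/n≡m; %-distribˡ-*;
          [m+kn]%n≡m%n )
open import Data.Nat.Divisibility
  using ( _∣_; _∤_; divides; _∣?_; ∣m∣n⇒∣m+n; ∣m+n∣m⇒∣n; ∣m⇒∣m*n; ∣n⇒∣m*n; m∣m*n; n∣m*n; ∣⇒≤;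
          n∣m⇒m%n≡0 )
open import Data.Nat.GCD using (gcd; gcd-greatest; module Bézout)
open import Data.Nat.Induction using (<-rec)
open import Data.Nat.Primality using (Prime; prime⇒irreducible; prime⇒nonZero; euclidsLemma)
import Data.Nat.Properties as ℕ
open import Data.Nat.Solver using () renaming (module +-*-Solver to ℕ-Solver)
open import Data.Product using (_×_; _,_; ∃-syntax)
open import Data.Sum using (_⊎_; inj₁; inj₂; [_,_]; [_,_]′)
open import Defs
open import Function using (_∘_; id)
open import Level using (0ℓ)
open import Relation.Binary.Definitions using (WeaklyDecidable)
open import Relation.Binary.PropositionalEquality
  using ( _≡_; _≢_; refl; sym; trans; cong; cong₂; subst; subst₂; module ≡-Reasoning )
import Relation.Binary.Reasoning.Setoid as SetoidReasoning
open import Relation.Nullary using (yes; no; does; ¬_; contradiction)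
open import Relation.Nullary.Decidable using (dec-true; dec-false; toSum)
open import Relation.Unary using (Pred; Decidable)

-- Partial theta sums and their products

-- Behind the relation between F, φ(-q) and ψ(-q) stand three products: F = (-q²; q²)/(q; q²), φ(-q)
-- = (q; q)/(-q; q) and ψ(-q) = (q²; q²)/(-q; q²). The obstacle is that all of them are infinite.
-- Instead of taking limits, the proof uses finite versions: partitions with parts at most k, finite
-- Pochhammer products, and partial theta sums Yₙ. For the latter, (c; q)ₙYₙ equals (q; q)ₙ plus
-- terms divisible by cqⁿ, exactly and in any commutative ring. Modulo a power of q the variable is
-- nilpotent, so these corrections vanish for large n, and every factor 1 - qx can be cancelled. The
-- two quadratic forms come from completing the square: 8T + 1 = x² for triangular T, while 8y² =
-- 2(2y)² and 8 · 2y² = (4y)².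

module ThetaSums {c ℓ} (R : CommutativeRing c ℓ)
  (ι : CommutativeRing.rawRing ℤ.+-*-commutativeRing -Raw-AlmostCommutative⟶ fromCommutativeRing R)
  where

  open CommutativeRing R public
    renaming ( Carrier to Elt; _+_ to _⊕_; _*_ to _⊛_; -_ to ⊖_; _-_ to _⊝_; 1# to 𝟏; 0# to 𝟎
             ; refl to ≈-refl; sym to ≈-sym; trans to ≈-trans )
    using ( _≈_; setoid; semiring; +-cong; +-identityˡ; +-identityʳ; -‿cong; *-cong; *-assoc;
            *-identityˡ; *-identityʳ; zeroˡ; zeroʳ )
  open Exp semiring public using (^-congˡ) renaming (_^_ to _⋆_)
  open SetoidReasoning setoid

  coeff-≟ : WeaklyDecidable (Induced-equivalence ι)
  coeff-≟ x y with x ℤ.≟ y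
  ... | yes refl = just ≈-refl
  ... | no  _    = nothing

  open RingSolver (CommutativeRing.rawRing ℤ.+-*-commutativeRing)
    (fromCommutativeRing R) ι coeff-≟ public using (solve; _:=_; _:+_; _:*_; _:-_; :-_; _:^_; con; Polynomial)

  -- con 1ℤ evaluates to ι 1ℤ, which is not definitionally 𝟏; a zeroth power is.
  one : ∀ {n} → Polynomial n
  one = con 1ℤ :^ 0

  -- Hands a hypothesis u ≈ v to the ring solver: k is its cofactor in f − g.
  cancel-difference : ∀ {f g k u v} → u ≈ v → f ≈ g ⊕ k ⊛ (u ⊝ v) → f ≈ g
  cancel-difference {f} {g} {k} {u} {v} u≈v p = begin
    f                 ≈⟨ p ⟩
    g ⊕ k ⊛ (u ⊝ v)   ≈⟨ +-cong ≈-refl (*-cong (≈-refl {k}) (+-cong u≈v ≈-refl)) ⟩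
    g ⊕ k ⊛ (v ⊝ v)   ≈⟨ solve 3 (λ g k v → g :+ k :* (v :- v) := g) ≈-refl g k v ⟩
    g                 ∎

  -- (x; q)ₘ
  poch : Elt → Elt → ℕ → Elt
  poch q x zero    = 𝟏
  poch q x (suc m) = (𝟏 ⊝ x) ⊛ poch q (x ⊛ q) m

  poch-cong : ∀ q {x y} m → x ≈ y → poch q x m ≈ poch q y m
  poch-cong q zero    x≈y = ≈-refl
  poch-cong q {x} {y} (suc m) x≈y = *-cong
    (cancel-difference {k = ⊖ 𝟏} x≈y
      (solve 2 (λ x y → one :- x := one :- y :+ (:- one) :* (x :- y)) ≈-refl x y))
    (poch-cong q m (*-cong x≈y ≈-refl))

  poch-suc : ∀ q x m → poch q x (suc m) ≈ poch q x m ⊛ (𝟏 ⊝ x ⊛ q ⋆ m)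
  poch-suc q x zero    =
    solve 1 (λ x → (one :- x) :* one := one :* (one :- x :* one)) ≈-refl x
  poch-suc q x (suc m) = begin
    (𝟏 ⊝ x) ⊛ poch q (x ⊛ q) (suc m)
      ≈⟨ *-cong ≈-refl (poch-suc q (x ⊛ q) m) ⟩
    (𝟏 ⊝ x) ⊛ (poch q (x ⊛ q) m ⊛ (𝟏 ⊝ x ⊛ q ⊛ q ⋆ m))
      ≈⟨ solve 4 (λ x q p b → (one :- x) :* (p :* (one :- x :* q :* b))
                           := (one :- x) :* p :* (one :- x :* (q :* b)))
           ≈-refl x q (poch q (x ⊛ q) m) (q ⋆ m) ⟩
    (𝟏 ⊝ x) ⊛ poch q (x ⊛ q) m ⊛ (𝟏 ⊝ x ⊛ q ⋆ suc m) ∎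

  -- Σ_{i ≤ j} (ax; q)ᵢ (xqⁱ⁺¹; q)ⱼ₋ᵢ zⁱ, a partial Rogers–Fine sum with denominators cleared.
  fineSum : Elt → Elt → Elt → ℕ → Elt → Elt
  fineSum q a x zero    z = 𝟏
  fineSum q a x (suc j) z = poch q (x ⊛ q) (suc j) ⊕ (𝟏 ⊝ a ⊛ x) ⊛ z ⊛ fineSum q a (x ⊛ q) j z

  fineSum-cong : ∀ q a x j {z z′} → z ≈ z′ → fineSum q a x j z ≈ fineSum q a x j z′
  fineSum-cong q a x zero    z≈z′ = ≈-refl
  fineSum-cong q a x (suc j) z≈z′ = +-cong ≈-refl
    (*-cong (*-cong ≈-refl z≈z′) (fineSum-cong q a (x ⊛ q) j z≈z′))

  -- Fine's relation (1 - w)f(w) = (1 - x) + x(1 - aw)f(qw), truncated and multiplied by (xq; q)ⱼ.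
  -- The hypothesis turns 1 - aw into 1 - xqʲ⁺¹, which is the factor that takes the cleared
  -- denominators from j to j + 1. The last summand is the error of truncation.
  fineSum-contiguous : ∀ q a x w j → a ⊛ w ≈ x ⊛ q ⋆ suc j →
    x ⊛ fineSum q a x (suc j) (q ⊛ w) ⊕ (𝟏 ⊝ x) ⊛ poch q (x ⊛ q) j ≈
    (𝟏 ⊝ w) ⊛ fineSum q a x j w ⊕ poch q (a ⊛ x) (suc j) ⊛ w ⋆ suc j ⊛ (𝟏 ⊕ x ⊛ q ⋆ suc j)
  fineSum-contiguous q a x w zero h = cancel-difference {k = x} h
    (solve 4 (λ q a x w →
        x :* ((one :- x :* q) :* one :+ (one :- a :* x) :* (q :* w) :* one)
          :+ (one :- x) :* one
      := (one :- w) :* one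
          :+ ((one :- a :* x) :* one) :* (w :* one) :* (one :+ x :* (q :* one))
          :+ x :* (a :* w :- x :* (q :* one)))
      ≈-refl q a x w)
  fineSum-contiguous q a x w (suc j) h =
    cancel-difference {k = x ⊛ P} h
    (cancel-difference {k = (𝟏 ⊝ a ⊛ x) ⊛ w} IH
    (cancel-difference {k = x} (poch-suc q (x ⊛ q) (suc j))
    (cancel-difference {k = (𝟏 ⊝ a ⊛ x) ⊛ (w ⊛ W) ⊛ (𝟏 ⊕ x ⊛ (q ⊛ b))}
       (poch-cong q {a ⊛ (x ⊛ q)} {a ⊛ x ⊛ q} (suc j) (≈-sym (*-assoc a x q)))
    (solve 12 (λ q a x w W b P₀ P₂ L₀ L₁ A A′ →
        let P = (one :- x :* q) :* P₀ in
        x :* (P₂ :+ (one :- a :* x) :* (q :* w) :* L₁) :+ (one :- x) :* P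
      := (one :- w) :* (P :+ (one :- a :* x) :* w :* L₀)
          :+ (one :- a :* x) :* A′ :* (w :* W) :* (one :+ x :* (q :* b))
          :+ x :* P :* (a :* w :- x :* (q :* b))
          :+ (one :- a :* x) :* w :*
              ((x :* q :* L₁ :+ (one :- x :* q) :* P₀)
                :- ((one :- w) :* L₀ :+ A :* W :* (one :+ x :* q :* b)))
          :+ x :* (P₂ :- P :* (one :- x :* q :* b))
          :+ (one :- a :* x) :* (w :* W) :* (one :+ x :* (q :* b)) :* (A :- A′))
      ≈-refl q a x w W b P₀ (poch q (x ⊛ q) (suc (suc j))) (fineSum q a (x ⊛ q) j w)
        (fineSum q a (x ⊛ q) (suc j) (q ⊛ w)) (poch q (a ⊛ (x ⊛ q)) (suc j)) (poch q (a ⊛ x ⊛ q) (suc j))))))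
    where
    W  = w ⋆ suc j
    b  = q ⋆ suc j
    P₀ = poch q (x ⊛ q ⊛ q) j
    P  = poch q (x ⊛ q) (suc j)
    IH = fineSum-contiguous q a (x ⊛ q) w j (≈-trans h (≈-sym (*-assoc x q b)))

  fineSum-0 : ∀ q a x j → fineSum q a x j 𝟎 ≈ poch q (x ⊛ q) j
  fineSum-0 q a x zero    = ≈-refl
  fineSum-0 q a x (suc j) = begin
    poch q (x ⊛ q) (suc j) ⊕ (𝟏 ⊝ a ⊛ x) ⊛ 𝟎 ⊛ fineSum q a (x ⊛ q) j 𝟎
      ≈⟨ +-cong ≈-refl (*-cong (zeroʳ _) ≈-refl) ⟩
    poch q (x ⊛ q) (suc j) ⊕ 𝟎 ⊛ fineSum q a (x ⊛ q) j 𝟎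
      ≈⟨ +-cong ≈-refl (zeroˡ _) ⟩
    poch q (x ⊛ q) (suc j) ⊕ 𝟎
      ≈⟨ +-identityʳ _ ⟩
    poch q (x ⊛ q) (suc j) ∎

  -- Shanks's argument.  For (q, a, c) = (q, −1, −q) and (q², −q, −q) the partial sums Y are those
  -- of φ(−q) and ψ(−q).
  theta-fineSum : ∀ {q a c} (Y : ℕ → Elt) → a ⊛ c ≈ q → Y 0 ≈ 𝟏 →
    (∀ n → poch q c (suc n) ⊛ Y (suc n) ≈
           poch q c (suc n) ⊛ Y n ⊕ poch q a (suc n) ⊛ (c ⊛ q ⋆ n) ⋆ suc n ⊛ (𝟏 ⊕ q ⋆ suc n)) →
    ∀ n → poch q c n ⊛ Y n ≈ fineSum q a 𝟏 n (c ⊛ q ⋆ n)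
  theta-fineSum Y ac≈q Y₀ step zero = ≈-trans (*-identityˡ _) Y₀
  theta-fineSum {q} {a} {c} Y ac≈q Y₀ step (suc n) =
    -- At x = 1 the summand (1 - x)(xq; q)ₙ of `fineSum-contiguous` drops out. What remains
    -- multiplies by 1 - cqⁿ, the factor that takes (c; q)ₙ to (c; q)ₙ₊₁, so both sides obey the
    -- same recurrence.
    cancel-difference {k = 𝟏} (step n)
    (cancel-difference {k = 𝟏 ⊝ w} (theta-fineSum Y ac≈q Y₀ step n)
    (cancel-difference {k = Y n} (poch-suc q c n)
    (cancel-difference {k = ⊖ 𝟏} (fineSum-contiguous q a 𝟏 w n a⊛w)
    (cancel-difference {k = 𝟏} (fineSum-cong q a 𝟏 (suc n) {q ⊛ w} {c ⊛ q ⋆ suc n}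
      (solve 3 (λ q c b → q :* (c :* b) := c :* (q :* b)) ≈-refl q c (q ⋆ n)))
    (cancel-difference {k = ⊖ (w ⋆ suc n ⊛ (𝟏 ⊕ q ⋆ suc n))} (poch-cong q (suc n) (*-identityʳ a))
    (solve 13 (λ w W b C₀ C₁ Y₀ Y₁ A A′ F₀ F₁ F₁′ P →
        C₁ :* Y₁
      := F₁′
        :+ one :* (C₁ :* Y₁ :- (C₁ :* Y₀ :+ A :* W :* (one :+ b)))
        :+ (one :- w) :* (C₀ :* Y₀ :- F₀)
        :+ Y₀ :* (C₁ :- C₀ :* (one :- w))
        :+ (:- one) :* (one :* F₁ :+ (one :- one) :* P :- ((one :- w) :* F₀ :+ A′ :* W :* (one :+ one :* b)))
        :+ one :* (F₁ :- F₁′)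
        :+ (:- (W :* (one :+ b))) :* (A′ :- A)
      ) ≈-refl w (w ⋆ suc n) (q ⋆ suc n) (poch q c n) (poch q c (suc n)) (Y n) (Y (suc n))
        (poch q a (suc n)) (poch q (a ⊛ 𝟏) (suc n))
        (fineSum q a 𝟏 n w) (fineSum q a 𝟏 (suc n) (q ⊛ w)) (fineSum q a 𝟏 (suc n) (c ⊛ q ⋆ suc n))
        (poch q (𝟏 ⊛ q) n)))))))
    where
    w = c ⊛ q ⋆ n
    a⊛w : a ⊛ w ≈ 𝟏 ⊛ q ⋆ suc n
    a⊛w = ≈-trans (≈-sym (*-assoc a c (q ⋆ n))) (≈-trans (*-cong ac≈q ≈-refl) (≈-sym (*-identityˡ _)))

  -- This replaces the passage to the limit: once cqⁿ is zero, the sum in powers of z collapses to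
  -- its term i = 0.
  theta-product : ∀ {q a c} (Y : ℕ → Elt) → a ⊛ c ≈ q → Y 0 ≈ 𝟏 →
    (∀ n → poch q c (suc n) ⊛ Y (suc n) ≈
           poch q c (suc n) ⊛ Y n ⊕ poch q a (suc n) ⊛ (c ⊛ q ⋆ n) ⋆ suc n ⊛ (𝟏 ⊕ q ⋆ suc n)) →
    ∀ n → c ⊛ q ⋆ n ≈ 𝟎 → poch q c n ⊛ Y n ≈ poch q q n
  theta-product {q} {a} {c} Y ac≈q Y₀ step n cqⁿ≈0 = begin
    poch q c n ⊛ Y n          ≈⟨ theta-fineSum Y ac≈q Y₀ step n ⟩
    fineSum q a 𝟏 n (c ⊛ q ⋆ n)  ≈⟨ fineSum-cong q a 𝟏 n cqⁿ≈0 ⟩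
    fineSum q a 𝟏 n 𝟎            ≈⟨ fineSum-0 q a 𝟏 n ⟩
    poch q (𝟏 ⊛ q) n          ≈⟨ poch-cong q n (*-identityˡ q) ⟩
    poch q q n                ∎

  -- Partial sums of φ(-q) and ψ(-q)

  φ-tail : Elt → ℕ → Elt
  φ-tail X zero    = 𝟎
  φ-tail X (suc n) = φ-tail X n ⊕ (⊖ X ⊛ X ⋆ n) ⋆ suc n

  φ-sum : Elt → ℕ → Elt
  φ-sum X n = 𝟏 ⊕ (φ-tail X n ⊕ φ-tail X n)

  -- Each step adds two consecutive triangular exponents, (n + 1)(2n + 1) and (n + 1)(2n + 3), which
  -- carry the same sign (-1)ⁿ⁺¹.
  ψ-sum : Elt → ℕ → Elt
  ψ-sum X zero    = 𝟏
  ψ-sum X (suc n) = ψ-sum X n ⊕ (⊖ X ⊛ (X ⊛ X) ⋆ n) ⋆ suc n ⊛ (𝟏 ⊕ (X ⊛ X) ⋆ suc n)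

  -- For a = -1 one has (-1; X)ₙ₊₁ = 2(-X; X)ₙ, and the factor 1 + Xⁿ⁺¹ of the recurrence completes
  -- this to 2(-X; X)ₙ₊₁. Hence the 2 in φ(-q) = 1 + 2S.
  φ-product : ∀ X n → ⊖ X ⊛ X ⋆ n ≈ 𝟎 → poch X (⊖ X) n ⊛ φ-sum X n ≈ poch X X n
  φ-product X = theta-product (φ-sum X)
    (solve 1 (λ X → (:- one) :* (:- X) := X) ≈-refl X)
    (≈-trans (+-cong ≈-refl (+-identityˡ 𝟎)) (+-identityʳ 𝟏))
    λ n →
      cancel-difference {k = y n ⊕ y n} (poch-suc X (⊖ X) n)
      (cancel-difference {k = ⊖ ((𝟏 ⊕ 𝟏) ⊛ y n ⊛ (𝟏 ⊕ X ⋆ suc n))}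
        (poch-cong X n (solve 1 (λ X → (:- one) :* X := :- X) ≈-refl X))
      (solve 7 (λ X b T y C C₁ C′ →
          C₁ :* (one :+ ((T :+ y) :+ (T :+ y)))
        := C₁ :* (one :+ (T :+ T)) :+ (one :- (:- one)) :* C′ :* y :* (one :+ X :* b)
           :+ (y :+ y) :* (C₁ :- C :* (one :- (:- X) :* b))
           :+ (:- ((one :+ one) :* y :* (one :+ X :* b))) :* (C′ :- C))
        ≈-refl X (X ⋆ n) (φ-tail X n) (y n) (poch X (⊖ X) n) (poch X (⊖ X) (suc n)) (poch X (⊖ 𝟏 ⊛ X) n)))
    where
    y : ℕ → Elt
    y n = (⊖ X ⊛ X ⋆ n) ⋆ suc n

  -- Here a = c = -X, so the two Pochhammer products of the recurrence coincide and each summand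
  -- enters with coefficient 1.
  ψ-product : ∀ X n → ⊖ X ⊛ (X ⊛ X) ⋆ n ≈ 𝟎 →
              poch (X ⊛ X) (⊖ X) n ⊛ ψ-sum X n ≈ poch (X ⊛ X) (X ⊛ X) n
  ψ-product X = theta-product (ψ-sum X)
    (solve 1 (λ X → (:- X) :* (:- X) := X :* X) ≈-refl X) ≈-refl
    λ n → solve 4 (λ C Y y b → C :* (Y :+ y :* (one :+ b)) := C :* Y :+ C :* y :* (one :+ b)) ≈-refl
      (poch (X ⊛ X) (⊖ X) (suc n)) (ψ-sum X n) ((⊖ X ⊛ (X ⊛ X) ⋆ n) ⋆ suc n) ((X ⊛ X) ⋆ suc n)

  poch-double : ∀ q x n → poch q x (n * 2) ≈ poch (q ⊛ q) x n ⊛ poch (q ⊛ q) (x ⊛ q) n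
  poch-double q x zero    = ≈-sym (*-identityˡ 𝟏)
  poch-double q x (suc n) = begin
    (𝟏 ⊝ x) ⊛ ((𝟏 ⊝ x ⊛ q) ⊛ poch q (x ⊛ q ⊛ q) (n * 2))
      ≈⟨ *-cong ≈-refl (*-cong ≈-refl (≈-trans (poch-double q (x ⊛ q ⊛ q) n)
           (*-cong (poch-cong (q ⊛ q) n (*-assoc x q q)) (poch-cong (q ⊛ q) n (*-assoc (x ⊛ q) q q))))) ⟩
    (𝟏 ⊝ x) ⊛ ((𝟏 ⊝ x ⊛ q) ⊛ (A ⊛ B))
      ≈⟨ solve 4 (λ u v A B → u :* (v :* (A :* B)) := u :* A :* (v :* B)) ≈-refl (𝟏 ⊝ x) (𝟏 ⊝ x ⊛ q) A B ⟩
    (𝟏 ⊝ x) ⊛ A ⊛ ((𝟏 ⊝ x ⊛ q) ⊛ B) ∎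
    where
    A = poch (q ⊛ q) (x ⊛ (q ⊛ q)) n
    B = poch (q ⊛ q) (x ⊛ q ⊛ (q ⊛ q)) n

  square-⋆ : ∀ x n → (x ⊛ x) ⋆ n ≈ x ⋆ (n * 2)
  square-⋆ x zero    = ≈-refl
  square-⋆ x (suc n) = ≈-trans (*-cong ≈-refl (square-⋆ x n)) (*-assoc x x _)

  ⊛-⋆ : ∀ x y n → (x ⊛ y) ⋆ n ≈ x ⋆ n ⊛ y ⋆ n
  ⊛-⋆ x y zero    = ≈-sym (*-identityˡ 𝟏)
  ⊛-⋆ x y (suc n) = ≈-trans (*-cong ≈-refl (⊛-⋆ x y n))
    (solve 4 (λ x y a b → x :* y :* (a :* b) := x :* a :* (y :* b)) ≈-refl x y (x ⋆ n) (y ⋆ n))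

  -- Cancellation of unipotent factors

  Cancellable : Elt → Set _
  Cancellable u = ∀ {f g} → u ⊛ f ≈ u ⊛ g → f ≈ g

  -- The hypothesis of cancellation says f - g = x(f - g); iterated k times it gives f - g = xᵏ(f -
  -- g) = 0.
  unipotent-cancellable : ∀ {x} k → x ⋆ k ≈ 𝟎 → Cancellable (𝟏 ⊝ x)
  unipotent-cancellable {x} k xᵏ≈0 {f} {g} h = begin
    f                        ≈⟨ solve 2 (λ f g → f := g :+ (one :* (f :- g))) ≈-refl f g ⟩
    g ⊕ x ⋆ 0 ⊛ (f ⊝ g)      ≈⟨ +-cong ≈-refl (absorb k) ⟩
    g ⊕ x ⋆ k ⊛ (f ⊝ g)      ≈⟨ +-cong ≈-refl (*-cong xᵏ≈0 ≈-refl) ⟩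
    g ⊕ 𝟎 ⊛ (f ⊝ g)          ≈⟨ +-cong ≈-refl (zeroˡ _) ⟩
    g ⊕ 𝟎                    ≈⟨ +-identityʳ g ⟩
    g                        ∎
    where
    absorb : ∀ k → x ⋆ 0 ⊛ (f ⊝ g) ≈ x ⋆ k ⊛ (f ⊝ g)
    absorb zero    = ≈-refl
    absorb (suc k) = ≈-trans (absorb k) (cancel-difference {k = x ⋆ k} h
      (solve 4 (λ x b f g → b :* (f :- g) := x :* b :* (f :- g)
                 :+ b :* ((one :- x) :* f :- (one :- x) :* g)) ≈-refl x (x ⋆ k) f g))

  -- The cofactor r witnesses that x, and with it every xqⁱ, is a multiple of X and hence nilpotent.
  poch-cancellable : ∀ {X} k → X ⋆ k ≈ 𝟎 → ∀ q x r m → x ≈ X ⊛ r → Cancellable (poch q x m)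
  poch-cancellable     k Xᵏ≈0 q x r zero    x≈Xr h =
    ≈-trans (≈-sym (*-identityˡ _)) (≈-trans h (*-identityˡ _))
  poch-cancellable {X} k Xᵏ≈0 q x r (suc m) x≈Xr h =
    poch-cancellable k Xᵏ≈0 q (x ⊛ q) (r ⊛ q) m (≈-trans (*-cong x≈Xr ≈-refl) (*-assoc X r q))
      (unipotent-cancellable k xᵏ≈0 (≈-trans (≈-sym (*-assoc _ _ _)) (≈-trans h (*-assoc _ _ _))))
    where
    xᵏ≈0 : x ⋆ k ≈ 𝟎
    xᵏ≈0 = ≈-trans (^-congˡ k x≈Xr) (≈-trans (⊛-⋆ X r k) (≈-trans (*-cong Xᵏ≈0 ≈-refl) (zeroˡ _)))

  -- The product for ped and its relation to φ and ψ

  module PedProduct (X : Elt) (G : ℕ → Elt) (G₀ : G 0 ≈ 𝟏)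
    (G-odd  : ∀ n → (𝟏 ⊝ X ⋆ suc (n * 2)) ⊛ G (suc (n * 2)) ≈ G (n * 2))
    (G-even : ∀ n → G (suc n * 2) ≈ (𝟏 ⊕ X ⋆ (suc n * 2)) ⊛ G (suc (n * 2)))
    where

    private
      Q = X ⊛ X

    -- Allowing one more part size m divides by 1 - Xᵐ if m is odd and multiplies by 1 + Xᵐ if m is
    -- even. For m = 2n + 2 the latter is the Pochhammer factor 1 - (-X²)X²ⁿ.
    ped-product : ∀ n → poch Q X n ⊛ G (n * 2) ≈ poch Q (⊖ X ⊛ X) n
    ped-product zero    = ≈-trans (*-identityˡ _) G₀
    ped-product (suc n) = begin
      poch Q X (suc n) ⊛ G (suc n * 2)
        ≈⟨ *-cong (≈-trans (poch-suc Q X n) (*-cong ≈-refl 1-XQⁿ)) (G-even n) ⟩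
      poch Q X n ⊛ (𝟏 ⊝ X ⊛ b) ⊛ ((𝟏 ⊕ X ⊛ (X ⊛ b)) ⊛ G (suc (n * 2)))
        ≈⟨ solve 4 (λ X P b g → P :* (one :- X :* b) :* ((one :+ X :* (X :* b)) :* g)
                  := P :* ((one :- X :* b) :* g) :* (one :- (:- X) :* X :* b))
             ≈-refl X (poch Q X n) b (G (suc (n * 2))) ⟩
      poch Q X n ⊛ ((𝟏 ⊝ X ⊛ b) ⊛ G (suc (n * 2))) ⊛ (𝟏 ⊝ ⊖ X ⊛ X ⊛ b)
        ≈⟨ *-cong (≈-trans (*-cong ≈-refl (G-odd n)) (ped-product n)) 1+XXQⁿ ⟩
      poch Q (⊖ X ⊛ X) n ⊛ (𝟏 ⊝ ⊖ X ⊛ X ⊛ Q ⋆ n)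
        ≈⟨ ≈-sym (poch-suc Q (⊖ X ⊛ X) n) ⟩
      poch Q (⊖ X ⊛ X) (suc n) ∎
      where
      b = X ⋆ (n * 2)
      1-XQⁿ : 𝟏 ⊝ X ⊛ Q ⋆ n ≈ 𝟏 ⊝ X ⊛ b
      1-XQⁿ = +-cong ≈-refl (-‿cong (*-cong ≈-refl (square-⋆ X n)))
      1+XXQⁿ : 𝟏 ⊝ ⊖ X ⊛ X ⊛ b ≈ 𝟏 ⊝ ⊖ X ⊛ X ⊛ Q ⋆ n
      1+XXQⁿ = +-cong ≈-refl (-‿cong (*-cong ≈-refl (≈-sym (square-⋆ X n))))

    -- After multiplication by (-X; X²)ₙ(-X²; X²)ₙ = (-X; X)₂ₙ both theta products apply, and
    -- `ped-product` exchanges (X; X²)ₙ for (-X²; X²)ₙ. The index is 2n for φ and n for ψ so that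
    -- the single condition X²ⁿ⁺¹ = 0 removes both corrections.
    ped-φ≈ψ : ∀ n → X ⋆ suc (n * 2) ≈ 𝟎 → G (n * 2) ⊛ φ-sum X (n * 2) ≈ ψ-sum X n
    ped-φ≈ψ n X≈0 =
      poch-cancellable (suc (n * 2)) X≈0 Q (⊖ X) (⊖ 𝟏) n (solve 1 (λ X → :- X := X :* (:- one)) ≈-refl X)
      (poch-cancellable (suc (n * 2)) X≈0 Q (⊖ X ⊛ X) (⊖ X) n (solve 1 (λ X → (:- X) :* X := X :* (:- X)) ≈-refl X)
      (begin
        E′ ⊛ (O′ ⊛ (g ⊛ φ))
          ≈⟨ solve 4 (λ E O g φ → E :* (O :* (g :* φ)) := g :* (O :* E :* φ)) ≈-refl E′ O′ g φ ⟩
        g ⊛ (O′ ⊛ E′ ⊛ φ)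
          ≈⟨ *-cong ≈-refl (*-cong (≈-sym (poch-double X (⊖ X) n)) ≈-refl) ⟩
        g ⊛ (poch X (⊖ X) (n * 2) ⊛ φ)
          ≈⟨ *-cong ≈-refl (φ-product X (n * 2) (vanish ≈-refl)) ⟩
        g ⊛ poch X X (n * 2)
          ≈⟨ *-cong ≈-refl (poch-double X X n) ⟩
        g ⊛ (O ⊛ E)
          ≈⟨ solve 3 (λ g O E → g :* (O :* E) := O :* g :* E) ≈-refl g O E ⟩
        O ⊛ g ⊛ E
          ≈⟨ *-cong (ped-product n) (≈-sym (ψ-product X n (vanish (square-⋆ X n)))) ⟩
        E′ ⊛ (O′ ⊛ ψ-sum X n) ∎))
      where
      g  = G (n * 2)
      φ  = φ-sum X (n * 2)
      O  = poch Q X n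
      O′ = poch Q (⊖ X) n
      E  = poch Q Q n
      E′ = poch Q (⊖ X ⊛ X) n
      vanish : ∀ {y} → y ≈ X ⋆ (n * 2) → ⊖ X ⊛ y ≈ 𝟎
      vanish {y} y≈ = begin
        ⊖ X ⊛ y                 ≈⟨ *-cong ≈-refl y≈ ⟩
        ⊖ X ⊛ X ⋆ (n * 2)       ≈⟨ solve 2 (λ X b → (:- X) :* b := (:- one) :* (X :* b)) ≈-refl X (X ⋆ (n * 2)) ⟩
        ⊖ 𝟏 ⊛ X ⋆ suc (n * 2)   ≈⟨ *-cong ≈-refl X≈0 ⟩
        ⊖ 𝟏 ⊛ 𝟎                 ≈⟨ zeroʳ _ ⟩
        𝟎                       ∎

-- Power series

Series : Set
Series = ℕ → ℤ

infixl 7 _⊛_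
infixl 6 _⊕_
infix  8 ⊖_

tail : Series → Series
tail f n = f (suc n)

const : ℤ → Series
const c zero    = c
const c (suc _) = 0ℤ

X : Series
X zero    = 0ℤ
X (suc n) = const 1ℤ n

_⊕_ : Series → Series → Series
(f ⊕ g) n = f n ℤ.+ g n

⊖_ : Series → Series
(⊖ f) n = ℤ.- f n

-- The Cauchy product, by recursion along f = f(0) + X · `tail f`.
_⊛_ : Series → Series → Series
(f ⊛ g) zero    = f 0 ℤ.* g 0
(f ⊛ g) (suc n) = f 0 ℤ.* g (suc n) ℤ.+ (tail f ⊛ g) n

⊛-cong : ∀ {f f′ g g′} n → (∀ i → i ≤ n → f i ≡ f′ i) → (∀ i → i ≤ n → g i ≡ g′ i) →
         (f ⊛ g) n ≡ (f′ ⊛ g′) n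
⊛-cong zero    p q = cong₂ ℤ._*_ (p 0 z≤n) (q 0 z≤n)
⊛-cong (suc n) p q = cong₂ ℤ._+_
  (cong₂ ℤ._*_ (p 0 z≤n) (q (suc n) ℕ.≤-refl))
  (⊛-cong n (λ i i≤n → p (suc i) (s≤s i≤n)) (λ i i≤n → q i (ℕ.m≤n⇒m≤1+n i≤n)))

-- The definition peels the left factor; peeling the right one as well yields commutativity and,
-- later, the pairing in `square-even`.
⊛-suc : ∀ f g n → (f ⊛ g) (suc n) ≡ (f ⊛ tail g) n ℤ.+ f (suc n) ℤ.* g 0
⊛-suc f g zero    = refl
⊛-suc f g (suc n) = trans (cong (ℤ._+_ (f 0 ℤ.* g (suc (suc n)))) (⊛-suc (tail f) g n))
  (sym (ℤ.+-assoc (f 0 ℤ.* g (suc (suc n))) ((tail f ⊛ tail g) n) (f (suc (suc n)) ℤ.* g 0)))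

⊛-comm : ∀ f g n → (f ⊛ g) n ≡ (g ⊛ f) n
⊛-comm f g zero    = ℤ.*-comm (f 0) (g 0)
⊛-comm f g (suc n) = begin
  f 0 ℤ.* g (suc n) ℤ.+ (tail f ⊛ g) n ≡⟨ cong₂ ℤ._+_ (ℤ.*-comm (f 0) (g (suc n))) (⊛-comm (tail f) g n) ⟩
  g (suc n) ℤ.* f 0 ℤ.+ (g ⊛ tail f) n ≡⟨ ℤ.+-comm (g (suc n) ℤ.* f 0) ((g ⊛ tail f) n) ⟩
  (g ⊛ tail f) n ℤ.+ g (suc n) ℤ.* f 0 ≡⟨ sym (⊛-suc g f n) ⟩
  (g ⊛ f) (suc n)                      ∎
  where open ≡-Reasoning

⊛-distribʳ : ∀ f g h n → ((g ⊕ h) ⊛ f) n ≡ (g ⊛ f) n ℤ.+ (h ⊛ f) n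
⊛-distribʳ f g h zero    = ℤ.*-distribʳ-+ (f 0) (g 0) (h 0)
⊛-distribʳ f g h (suc n) = trans
  (cong (ℤ._+_ ((g 0 ℤ.+ h 0) ℤ.* f (suc n))) (⊛-distribʳ f (tail g) (tail h) n))
  (solve 5 (λ a b c u v → (a :+ b) :* c :+ (u :+ v) := a :* c :+ u :+ (b :* c :+ v)) refl
    (g 0) (h 0) (f (suc n)) ((tail g ⊛ f) n) ((tail h ⊛ f) n))
  where open ℤ-Solver

⊛-zeroˡ : ∀ f n → ((λ _ → 0ℤ) ⊛ f) n ≡ 0ℤ
⊛-zeroˡ f zero    = ℤ.*-zeroˡ (f 0)
⊛-zeroˡ f (suc n) = cong₂ ℤ._+_ (ℤ.*-zeroˡ (f (suc n))) (⊛-zeroˡ f n)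

const-⊛ : ∀ c f n → (const c ⊛ f) n ≡ c ℤ.* f n
const-⊛ c f zero    = refl
const-⊛ c f (suc n) = trans (cong (ℤ._+_ (c ℤ.* f (suc n))) (⊛-zeroˡ f n)) (ℤ.+-identityʳ _)

X-⊛ : ∀ f n → (X ⊛ f) (suc n) ≡ f n
X-⊛ f n = trans (cong₂ ℤ._+_ (ℤ.*-zeroˡ (f (suc n))) (const-⊛ 1ℤ f n))
  (trans (ℤ.+-identityˡ _) (ℤ.*-identityˡ (f n)))

⊛-scaleˡ : ∀ c f g n → ((λ i → c ℤ.* f i) ⊛ g) n ≡ c ℤ.* (f ⊛ g) n
⊛-scaleˡ c f g zero    = ℤ.*-assoc c (f 0) (g 0)
⊛-scaleˡ c f g (suc n) = trans
  (cong (ℤ._+_ (c ℤ.* f 0 ℤ.* g (suc n))) (⊛-scaleˡ c (tail f) g n))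
  (solve 4 (λ a b d u → a :* b :* d :+ a :* u := a :* (b :* d :+ u)) refl
    c (f 0) (g (suc n)) ((tail f ⊛ g) n))
  where open ℤ-Solver

⊛-assoc : ∀ f g h n → ((f ⊛ g) ⊛ h) n ≡ (f ⊛ (g ⊛ h)) n
⊛-assoc f g h zero    = ℤ.*-assoc (f 0) (g 0) (h 0)
⊛-assoc f g h (suc n) = begin
  a ℤ.* b ℤ.* c ℤ.+ (((λ i → a ℤ.* tail g i) ⊕ (tail f ⊛ g)) ⊛ h) n
    ≡⟨ cong (ℤ._+_ (a ℤ.* b ℤ.* c)) (⊛-distribʳ h (λ i → a ℤ.* tail g i) (tail f ⊛ g) n) ⟩
  a ℤ.* b ℤ.* c ℤ.+ (((λ i → a ℤ.* tail g i) ⊛ h) n ℤ.+ ((tail f ⊛ g) ⊛ h) n)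
    ≡⟨ cong (ℤ._+_ (a ℤ.* b ℤ.* c))
         (cong₂ ℤ._+_ (⊛-scaleˡ a (tail g) h n) (⊛-assoc (tail f) g h n)) ⟩
  a ℤ.* b ℤ.* c ℤ.+ (a ℤ.* (tail g ⊛ h) n ℤ.+ (tail f ⊛ (g ⊛ h)) n)
    ≡⟨ solve 5 (λ a b c u v → a :* b :* c :+ (a :* u :+ v) := a :* (b :* c :+ u) :+ v) refl
         a b c ((tail g ⊛ h) n) ((tail f ⊛ (g ⊛ h)) n) ⟩
  a ℤ.* (b ℤ.* c ℤ.+ (tail g ⊛ h) n) ℤ.+ (tail f ⊛ (g ⊛ h)) n ∎
  where
  open ≡-Reasoning
  open ℤ-Solver
  a = f 0
  b = g 0
  c = h (suc n)

-- A coefficient of a product is a nonempty sum of terms f i · g j, so closure under addition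
-- suffices. Both supports and evenness are obtained this way.
⊛-closed : ∀ (P : ℤ → Set) → (∀ {x y} → P x → P y → P (x ℤ.+ y)) → ∀ {f g} n →
           (∀ i j → i + j ≡ n → P (f i ℤ.* g j)) → P ((f ⊛ g) n)
⊛-closed P +-closed zero    p = p 0 0 refl
⊛-closed P +-closed (suc n) p =
  +-closed (p 0 (suc n) refl) (⊛-closed P +-closed n λ i j e → p (suc i) j (cong suc e))

-- ℤ[[q]]/(qᴺ⁺¹): equality up to degree N turns the infinite products into finite ones.
module Truncated (N : ℕ) where

  infix 4 _≈_

  record _≈_ (f g : Series) : Set where
    constructor agree
    field at : ∀ i → i ≤ N → f i ≡ g i

  open _≈_ public

  pointwise : ∀ {f g} → (∀ i → f i ≡ g i) → f ≈ g
  pointwise p = agree λ i _ → p i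

  seriesRing : CommutativeRing 0ℓ 0ℓ
  seriesRing = record
    { Carrier = Series ; _≈_ = _≈_ ; _+_ = _⊕_ ; _*_ = _⊛_ ; -_ = ⊖_
    ; 0# = λ _ → 0ℤ ; 1# = const 1ℤ
    ; isCommutativeRing = record
      { isRing = record
        { +-isAbelianGroup = record
          { isGroup = record
            { isMonoid = record
              { isSemigroup = record
                { isMagma = record
                  { isEquivalence = record
                    { refl  = pointwise λ _ → refl
                    ; sym   = λ p → agree λ i i≤N → sym (at p i i≤N)
                    ; trans = λ p q → agree λ i i≤N → trans (at p i i≤N) (at q i i≤N)
                    }
                  ; ∙-cong = λ p q → agree λ i i≤N → cong₂ ℤ._+_ (at p i i≤N) (at q i i≤N)
                  }
                ; assoc = λ f g h → pointwise λ i → ℤ.+-assoc (f i) (g i) (h i)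
                }
              ; identity = (λ f → pointwise λ i → ℤ.+-identityˡ (f i))
                         , (λ f → pointwise λ i → ℤ.+-identityʳ (f i))
              }
            ; inverse = (λ f → pointwise λ i → ℤ.+-inverseˡ (f i))
                      , (λ f → pointwise λ i → ℤ.+-inverseʳ (f i))
            ; ⁻¹-cong = λ p → agree λ i i≤N → cong ℤ.-_ (at p i i≤N)
            }
          ; comm = λ f g → pointwise λ i → ℤ.+-comm (f i) (g i)
          }
        ; *-cong = λ p q → agree λ n n≤N →
            ⊛-cong n (λ i i≤n → at p i (ℕ.≤-trans i≤n n≤N)) (λ i i≤n → at q i (ℕ.≤-trans i≤n n≤N))
        ; *-assoc    = λ f g h → pointwise (⊛-assoc f g h)
        ; *-identity = (λ f → pointwise (⊛-identityˡ f))
                     , (λ f → pointwise λ i → trans (⊛-comm f (const 1ℤ) i) (⊛-identityˡ f i))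
        ; distrib    = (λ f g h → pointwise λ i → trans (⊛-comm f (g ⊕ h) i)
                         (trans (⊛-distribʳ f g h i) (cong₂ ℤ._+_ (⊛-comm g f i) (⊛-comm h f i))))
                     , (λ f g h → pointwise (⊛-distribʳ f g h))
        }
      ; *-comm = λ f g → pointwise (⊛-comm f g)
      }
    }
    where
    ⊛-identityˡ : ∀ f i → (const 1ℤ ⊛ f) i ≡ f i
    ⊛-identityˡ f i = trans (const-⊛ 1ℤ f i) (ℤ.*-identityˡ (f i))

  const-homomorphism : CommutativeRing.rawRing ℤ.+-*-commutativeRing
                       -Raw-AlmostCommutative⟶ fromCommutativeRing seriesRing
  const-homomorphism = record
    { ⟦_⟧    = const
    ; +-homo = λ x y → pointwise λ { zero → refl ; (suc _) → refl }
    ; *-homo = λ x y → pointwise λ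
        { zero → refl ; (suc n) → sym (trans (const-⊛ x (const y) (suc n)) (ℤ.*-zeroʳ x)) }
    ; -‿homo = λ x → pointwise λ { zero → refl ; (suc _) → refl }
    ; 0-homo = pointwise λ { zero → refl ; (suc _) → refl }
    ; 1-homo = pointwise λ _ → refl
    }

-- Counting partitions

filter-cong-All : ∀ {A : Set} {P Q : Pred A 0ℓ} (P? : Decidable P) (Q? : Decidable Q) {xs} →
                  All (λ x → (P x → Q x) × (Q x → P x)) xs → filter P? xs ≡ filter Q? xs
filter-cong-All P? Q? [] = refl
filter-cong-All P? Q? {x ∷ xs} ((P⇒Q , Q⇒P) ∷ h) with P? x
... | yes p = trans (cong (x ∷_) (filter-cong-All P? Q? h)) (sym (filter-accept Q? (P⇒Q p)))
... | no ¬p = trans (filter-cong-All P? Q? h) (sym (filter-reject Q? (¬p ∘ Q⇒P)))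

length-filter-map : ∀ {A B : Set} {P : Pred B 0ℓ} (P? : Decidable P) (f : A → B) xs →
                    length (filter P? (map f xs)) ≡ length (filter (P? ∘ f) xs)
length-filter-map P? f []       = refl
length-filter-map P? f (x ∷ xs) with does (P? (f x))
... | true  = cong suc (length-filter-map P? f xs)
... | false = length-filter-map P? f xs

boxed-bounded : ∀ l k n → All (All (_≤ k)) (boxed l k n)
boxed-bounded l       k       zero    = [] ∷ []
boxed-bounded zero    k       (suc n) = []
boxed-bounded (suc l) zero    (suc n) = []
boxed-bounded (suc l) (suc k) (suc n) = All.++⁺
  (All.map (All.map ℕ.m≤n⇒m≤1+n) (boxed-bounded (suc l) k (suc n)))
  new
  where
  new : All (All (_≤ suc k)) (if k ≤ᵇ n then map (suc k ∷_) (boxed l (suc k) (n ∸ k)) else [])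
  new with k ≤ᵇ n
  ... | true  = All.map⁺ (All.map (ℕ.≤-refl ∷_) (boxed-bounded l (suc k) (n ∸ k)))
  ... | false = []

boxed-large : ∀ l k n → n ≤ k → boxed l k n ≡ boxed l n n
boxed-large l       k       zero    _         = refl
boxed-large zero    k       (suc n) _         = refl
boxed-large (suc l) (suc k) (suc n) (s≤s n≤k) with k ≤? n
... | yes k≤n rewrite ℕ.≤-antisym n≤k k≤n = refl
... | no  k≰n with k ≤ᵇ n in eq
...   | true  = contradiction (ℕ.≤ᵇ⇒≤ k n (subst T (sym eq) _)) k≰n
...   | false = trans (++-identityʳ _) (boxed-large (suc l) k (suc n) (ℕ.≰⇒> k≰n))

count : ℕ → ℕ → ℕ → ℕ
count l k n = length (filter evenPartsDistinct? (boxed l k n))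

cons-odd : ∀ {x} → 2 ∤ x → ∀ xs → EvenPartsDistinct (x ∷ xs) ≡ EvenPartsDistinct xs
cons-odd 2∤x xs = cong Unique (filter-reject (2 ∣?_) 2∤x)

cons-even : ∀ {x} → 2 ∣ x → ∀ xs → EvenPartsDistinct (x ∷ xs) ≡ Unique (x ∷ filter (2 ∣?_) xs)
cons-even 2∣x xs = cong Unique (filter-accept (2 ∣?_) 2∣x)

filter-cons-odd : ∀ {x} → 2 ∤ x → ∀ xss →
  filter (evenPartsDistinct? ∘ (x ∷_)) xss ≡ filter evenPartsDistinct? xss
filter-cons-odd {x} 2∤x = filter-≐ (evenPartsDistinct? ∘ (x ∷_)) evenPartsDistinct?
  ( (λ {xs} → subst (λ A → A) (cons-odd 2∤x xs))
  , (λ {xs} → subst (λ A → A) (sym (cons-odd 2∤x xs))))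

cons-even-iff : ∀ {k xs} → 2 ∣ suc k → All (_≤ k) xs →
  (EvenPartsDistinct (suc k ∷ xs) → EvenPartsDistinct xs) ×
  (EvenPartsDistinct xs → EvenPartsDistinct (suc k ∷ xs))
cons-even-iff {k} {xs} 2∣x xs≤k =
    (λ d → tail-unique (subst (λ A → A) (cons-even 2∣x xs) d))
  , (λ d → subst (λ A → A) (sym (cons-even 2∣x xs))
      (All.filter⁺ (2 ∣?_) (All.map (λ y≤k e → ℕ.<⇒≢ (s≤s y≤k) (sym e)) xs≤k) ∷ d))
  where
  tail-unique : ∀ {y ys} → Unique {A = ℕ} (y ∷ ys) → Unique ys
  tail-unique (_ ∷ u) = u

repeated-even : ∀ {x} → 2 ∣ x → ∀ xs → ¬ EvenPartsDistinct (x ∷ x ∷ xs)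
repeated-even {x} 2∣x xs d
  with subst Unique (trans (filter-accept (2 ∣?_) 2∣x) (cong (x ∷_) (filter-accept (2 ∣?_) 2∣x))) d
... | (x≢x ∷ _) ∷ _ = x≢x refl

-- A list that already starts with k + 1 would repeat an even part and is filtered out. On the
-- remaining lists, whose parts are at most k, prefixing k + 1 does not affect the distinctness of
-- even parts.
filter-cons-even : ∀ {k} → 2 ∣ suc k → ∀ l n →
  filter (evenPartsDistinct? ∘ (suc k ∷_)) (boxed l (suc k) n) ≡ filter evenPartsDistinct? (boxed l k n)
filter-cons-even {k} 2∣x = go
  where
  P? = evenPartsDistinct? ∘ (suc k ∷_)
  bounded : ∀ l n → filter P? (boxed l k n) ≡ filter evenPartsDistinct? (boxed l k n)
  bounded l n = filter-cong-All P? evenPartsDistinct?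
    (All.map (cons-even-iff 2∣x) (boxed-bounded l k n))
  go : ∀ l n → filter P? (boxed l (suc k) n) ≡ filter evenPartsDistinct? (boxed l k n)
  go l       zero    = bounded l zero
  go zero    (suc n) = refl
  go (suc l) (suc n) = trans (filter-++ P? (boxed (suc l) k (suc n)) _)
    (trans (cong₂ _++_ (bounded (suc l) (suc n)) none) (++-identityʳ _))
    where
    none : filter P? (if k ≤ᵇ n then map (suc k ∷_) (boxed l (suc k) (n ∸ k)) else []) ≡ []
    none with k ≤ᵇ n
    ... | true  = filter-none P? (All.map⁺ (All.universal (repeated-even 2∣x) (boxed l (suc k) (n ∸ k))))
    ... | false = refl

-- An even part occurs only once, so it forces the remaining parts to be smaller.
bound-after : ℕ → ℕ
bound-after k = if does (2 ∣? suc k) then k else suc k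

bound-after-even : ∀ {k} → 2 ∣ suc k → bound-after k ≡ k
bound-after-even {k} 2∣x = cong (if_then k else suc k) (dec-true (2 ∣? suc k) 2∣x)

bound-after-odd : ∀ {k} → 2 ∤ suc k → bound-after k ≡ suc k
bound-after-odd {k} 2∤x = cong (if_then k else suc k) (dec-false (2 ∣? suc k) 2∤x)

count-suc : ∀ l k n → count (suc l) (suc k) (suc n) ≡
  count (suc l) k (suc n) + (if k ≤ᵇ n then count l (bound-after k) (n ∸ k) else 0)
count-suc l k n = begin
  length (filter E? (boxed (suc l) k (suc n) ++ new))
    ≡⟨ cong length (filter-++ E? (boxed (suc l) k (suc n)) new) ⟩
  length (filter E? (boxed (suc l) k (suc n)) ++ filter E? new)
    ≡⟨ length-++ (filter E? (boxed (suc l) k (suc n))) ⟩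
  count (suc l) k (suc n) + length (filter E? new)
    ≡⟨ cong (count (suc l) k (suc n) +_) length-new ⟩
  count (suc l) k (suc n) + (if k ≤ᵇ n then count l (bound-after k) (n ∸ k) else 0) ∎
  where
  open ≡-Reasoning
  E? = evenPartsDistinct?
  new = if k ≤ᵇ n then map (suc k ∷_) (boxed l (suc k) (n ∸ k)) else []
  length-filter : ∀ m → length (filter (E? ∘ (suc k ∷_)) (boxed l (suc k) m)) ≡ count l (bound-after k) m
  length-filter m = [ even , odd ]′ (toSum (2 ∣? suc k))
    where
    even : 2 ∣ suc k → _
    even 2∣x = trans (cong length (filter-cons-even 2∣x l m))
      (cong (λ b → count l b m) (sym (bound-after-even 2∣x)))
    odd : 2 ∤ suc k → _
    odd 2∤x = trans (cong length (filter-cons-odd 2∤x (boxed l (suc k) m)))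
      (cong (λ b → count l b m) (sym (bound-after-odd 2∤x)))
  length-new : length (filter E? new) ≡ (if k ≤ᵇ n then count l (bound-after k) (n ∸ k) else 0)
  length-new with k ≤ᵇ n
  ... | false = refl
  ... | true  = trans (length-filter-map E? (suc k ∷_) (boxed l (suc k) (n ∸ k))) (length-filter (n ∸ k))

-- Parts are positive, so the weight drops at least as fast as the allowed number of parts, and a
-- bound l ≥ n never takes effect. It is needed because removing a part k + 1 lowers l by 1 only,
-- while `pedSeries` keeps l equal to the weight.
count-stable : ∀ l l′ k n → n ≤ l → n ≤ l′ → count l k n ≡ count l′ k n
count-stable l       l′       k       zero    _ _ = refl
count-stable (suc l) (suc l′) zero    (suc n) _ _ = refl
count-stable (suc l) (suc l′) (suc k) (suc n) (s≤s n≤l) (s≤s n≤l′) = begin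
  count (suc l) (suc k) (suc n)  ≡⟨ count-suc l k n ⟩
  count (suc l) k (suc n) + (if k ≤ᵇ n then count l (bound-after k) (n ∸ k) else 0)
    ≡⟨ cong₂ (λ a b → a + (if k ≤ᵇ n then b else 0))
         (count-stable (suc l) (suc l′) k (suc n) (s≤s n≤l) (s≤s n≤l′))
         (count-stable l l′ (bound-after k) (n ∸ k) (ℕ.≤-trans (ℕ.m∸n≤m n k) n≤l)
           (ℕ.≤-trans (ℕ.m∸n≤m n k) n≤l′)) ⟩
  count (suc l′) k (suc n) + (if k ≤ᵇ n then count l′ (bound-after k) (n ∸ k) else 0)
    ≡⟨ sym (count-suc l′ k n) ⟩
  count (suc l′) (suc k) (suc n) ∎
  where open ≡-Reasoning

-- Generating functions with bounded parts

pedSeries : ℕ → Series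
pedSeries k n = ℤ.+ count n k n

ped-coefficient : ∀ k n → n ≤ k → pedSeries k n ≡ ℤ.+ ped n
ped-coefficient k n n≤k = cong (ℤ.+_ ∘ length ∘ filter evenPartsDistinct?) (boxed-large n k n n≤k)

-- Multiplication by Xᵐ on coefficients, independent of any truncation; `X⋆-shift` identifies it
-- with the power in the truncated ring.
shift : ℕ → Series → Series
shift zero    f n       = f n
shift (suc m) f zero    = 0ℤ
shift (suc m) f (suc n) = shift m f n

shift-≤ : ∀ m f n → shift m f n ≡ (if m ≤ᵇ n then f (n ∸ m) else 0ℤ)
shift-≤ zero          f n       = refl
shift-≤ (suc m)       f zero    = refl
shift-≤ (suc zero)    f (suc n) = refl
shift-≤ (suc (suc m)) f (suc n) = shift-≤ (suc m) f n

pedSeries-zero : ∀ n → pedSeries 0 n ≡ const 1ℤ n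
pedSeries-zero zero    = refl
pedSeries-zero (suc n) = refl

pedSeries-suc : ∀ k n → pedSeries (suc k) n ≡ pedSeries k n ℤ.+ shift (suc k) (pedSeries (bound-after k)) n
pedSeries-suc k zero    = refl
pedSeries-suc k (suc n) = begin
  ℤ.+ count (suc n) (suc k) (suc n)
    ≡⟨ cong ℤ.+_ (count-suc n k n) ⟩
  ℤ.+ (count (suc n) k (suc n) + (if k ≤ᵇ n then count n (bound-after k) (n ∸ k) else 0))
    ≡⟨ cong (λ c → ℤ.+ (count (suc n) k (suc n) + (if k ≤ᵇ n then c else 0)))
         (count-stable n (n ∸ k) (bound-after k) (n ∸ k) (ℕ.m∸n≤m n k) ℕ.≤-refl) ⟩
  ℤ.+ (count (suc n) k (suc n) + (if k ≤ᵇ n then count (n ∸ k) (bound-after k) (n ∸ k) else 0))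
    ≡⟨ ℤ.pos-+ (count (suc n) k (suc n)) _ ⟩
  pedSeries k (suc n) ℤ.+ ℤ.+ (if k ≤ᵇ n then count (n ∸ k) (bound-after k) (n ∸ k) else 0)
    ≡⟨ cong (ℤ._+_ (pedSeries k (suc n)))
         (trans (Bool.if-float ℤ.+_ (k ≤ᵇ n)) (sym (shift-≤ k (pedSeries (bound-after k)) n))) ⟩
  pedSeries k (suc n) ℤ.+ shift k (pedSeries (bound-after k)) n ∎
  where open ≡-Reasoning

-- Nonresidues and norms

module _ where

  open ℕ-Solver

  ∣m+n∣n⇒∣m : ∀ {d m n} → d ∣ m + n → d ∣ n → d ∣ m
  ∣m+n∣n⇒∣m {d} {m} {n} d∣m+n = ∣m+n∣m⇒∣n (subst (d ∣_) (ℕ.+-comm m n) d∣m+n)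

  divides-reflected : ∀ {m d} x y → x + y ≡ m → m ∣ x * x + d → m ∣ y * y + d
  divides-reflected {m} {d} x y refl h = ∣m+n∣n⇒∣m
    (subst (x + y ∣_)
      (solve 3 (λ x y d → x :* x :+ d :+ y :* (x :+ y) := y :* y :+ d :+ x :* (x :+ y)) refl x y d)
      (∣m∣n⇒∣m+n h (n∣m*n y)))
    (n∣m*n x)

  divides-reduced : ∀ {m d} .{{_ : NonZero m}} x → m ∣ x * x + d → m ∣ (x % m) * (x % m) + d
  divides-reduced {m} {d} x h = ∣m+n∣n⇒∣m
    (subst (m ∣_)
      (trans (cong (λ x → x * x + d) (m≡m%n+[m/n]*n x m))
        (solve 4 (λ r q m d → (r :+ q :* m) :* (r :+ q :* m) :+ d
                           := r :* r :+ d :+ q :* (con 2 :* r :+ q :* m) :* m) refl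
          (x % m) (x / m) m d))
      h)
    (n∣m*n (x / m * (2 * (x % m) + x / m * m)))

  -- Both e and d are at most m - 1, so e² + d ≤ (m - 1)m < m².
  cofactor-< : ∀ {m d e k} → e < m → d < m → e * e + d ≡ k * m → k < m
  cofactor-< {suc t} {d} {e} {k} (s≤s e≤t) (s≤s d≤t) eq = ℕ.≰⇒> λ m≤k → ℕ.<-irrefl refl (begin-strict
    e * e + d        ≤⟨ ℕ.+-mono-≤ (ℕ.*-mono-≤ e≤t e≤t) d≤t ⟩
    t * t + t        ≡⟨ ℕ.+-comm (t * t) t ⟩
    t + t * t        ≡⟨ sym (ℕ.*-suc t t) ⟩
    t * suc t        <⟨ s≤s (ℕ.m≤n+m (t * suc t) t) ⟩
    suc t * suc t    ≤⟨ ℕ.*-monoˡ-≤ (suc t) m≤k ⟩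
    k * suc t        ≡⟨ sym eq ⟩
    e * e + d        ∎)
    where open ℕ.≤-Reasoning

  odd+odd≢odd : ∀ {a b c} → (1 + a * 2) + (1 + b * 2) ≢ 1 + c * 2
  odd+odd≢odd {a} {b} {c} eq = ℕ.even≢odd (1 + a + b) c (trans
    (solve 2 (λ a b → con 2 :* (con 1 :+ a :+ b) := (con 1 :+ a :* con 2) :+ (con 1 :+ b :* con 2)) refl a b)
    (trans eq (cong suc (ℕ.*-comm c 2))))

  even+even≢odd : ∀ {a b c} → a * 2 + b * 2 ≢ 1 + c * 2
  even+even≢odd {a} {b} {c} eq = ℕ.even≢odd (a + b) c (trans
    (solve 2 (λ a b → con 2 :* (a :+ b) := a :* con 2 :+ b :* con 2) refl a b)
    (trans eq (cong suc (ℕ.*-comm c 2))))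

  parity : ∀ n → (∃[ b ] n ≡ b * 2) ⊎ (∃[ b ] n ≡ 1 + b * 2)
  parity n with n divMod 2
  ... | result b zero       eq = inj₁ (b , eq)
  ... | result b (suc zero) eq = inj₂ (b , eq)

  -- Since m is odd, the roots e and m - e have opposite parity, so the parity that the descent
  -- requires can be chosen.
  even-reflection : ∀ {m d c} e y → e < m → e + y ≡ m → m ≡ 1 + c * 2 → m ∣ e * e + d →
                    ∃[ b ] (b * 2 < m × m ∣ (b * 2) * (b * 2) + d)
  even-reflection {m} {d} {c} e y e<m e+y≡m m-odd h with parity e | parity y
  ... | inj₁ (b , refl) | _               = b , e<m , h
  ... | inj₂ (b , refl) | inj₁ (a , refl) =
    a , subst (a * 2 <_) e+y≡m (ℕ.m<n+m (a * 2) {1 + b * 2} (s≤s z≤n)) ,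
    divides-reflected (1 + b * 2) (a * 2) e+y≡m h
  ... | inj₂ (b , refl) | inj₂ (a , refl) = contradiction (trans e+y≡m m-odd) (odd+odd≢odd {b} {a} {c})

  odd-reflection : ∀ {m d c} e y → e < m → e + y ≡ m → m ≡ 1 + c * 2 → m ∤ d → m ∣ e * e + d →
                   ∃[ b ] (1 + b * 2 < m × m ∣ (1 + b * 2) * (1 + b * 2) + d)
  odd-reflection {m} {d} {c} e y e<m e+y≡m m-odd m∤d h with parity e | parity y
  ... | inj₂ (b , refl)     | _               = b , e<m , h
  -- The root e = 0 reflects to m itself, which is not below m; but then m would divide d.
  ... | inj₁ (zero , refl)  | _               = contradiction h m∤d
  ... | inj₁ (suc b , refl) | inj₂ (a , refl) =
    a , subst (1 + a * 2 <_) e+y≡m (ℕ.m<n+m (1 + a * 2) {suc b * 2} (s≤s z≤n)) ,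
    divides-reflected (suc b * 2) (1 + a * 2) e+y≡m h
  ... | inj₁ (suc b , refl) | inj₁ (a , refl) = contradiction (trans e+y≡m m-odd) (even+even≢odd {suc b} {a} {c})

  even-root : ∀ {m d c} → m ≡ 1 + c * 2 → ∀ x → m ∣ x * x + d → ∃[ b ] (b * 2 < m × m ∣ (b * 2) * (b * 2) + d)
  even-root {m@(suc _)} {c = c} m-odd x h = even-reflection {c = c} (x % m) (m ∸ x % m)
    (m%n<n x m) (ℕ.m+[n∸m]≡n (ℕ.<⇒≤ (m%n<n x m))) m-odd (divides-reduced x h)

  odd-root : ∀ {m d c} → m ≡ 1 + c * 2 → m ∤ d → ∀ x → m ∣ x * x + d →
             ∃[ b ] (1 + b * 2 < m × m ∣ (1 + b * 2) * (1 + b * 2) + d)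
  odd-root {m@(suc _)} {c = c} m-odd m∤d x h = odd-reflection {c = c} (x % m) (m ∸ x % m)
    (m%n<n x m) (ℕ.m+[n∸m]≡n (ℕ.<⇒≤ (m%n<n x m))) m-odd m∤d (divides-reduced x h)

  inverse-3-mod-4 : ∀ r → r < 4 → (r * 3) % 4 ≡ 1 → r ≡ 3
  inverse-3-mod-4 0 _ ()
  inverse-3-mod-4 1 _ ()
  inverse-3-mod-4 2 _ ()
  inverse-3-mod-4 3 _ _ = refl
  inverse-3-mod-4 (suc (suc (suc (suc _)))) (s≤s (s≤s (s≤s (s≤s ())))) _

  quotient-3/5-mod-8 : ∀ r → r < 8 → (r * 5) % 8 ≡ 3 → r ≡ 7
  quotient-3/5-mod-8 0 _ ()
  quotient-3/5-mod-8 1 _ ()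
  quotient-3/5-mod-8 2 _ ()
  quotient-3/5-mod-8 3 _ ()
  quotient-3/5-mod-8 4 _ ()
  quotient-3/5-mod-8 5 _ ()
  quotient-3/5-mod-8 6 _ ()
  quotient-3/5-mod-8 7 _ _ = refl
  quotient-3/5-mod-8 (suc (suc (suc (suc (suc (suc (suc (suc _))))))))
    (s≤s (s≤s (s≤s (s≤s (s≤s (s≤s (s≤s (s≤s ())))))))) _

  quotient-3/7-mod-8 : ∀ r → r < 8 → (r * 7) % 8 ≡ 3 → r ≡ 5
  quotient-3/7-mod-8 0 _ ()
  quotient-3/7-mod-8 1 _ ()
  quotient-3/7-mod-8 2 _ ()
  quotient-3/7-mod-8 3 _ ()
  quotient-3/7-mod-8 4 _ ()
  quotient-3/7-mod-8 5 _ _ = refl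
  quotient-3/7-mod-8 6 _ ()
  quotient-3/7-mod-8 7 _ ()
  quotient-3/7-mod-8 (suc (suc (suc (suc (suc (suc (suc (suc _))))))))
    (s≤s (s≤s (s≤s (s≤s (s≤s (s≤s (s≤s (s≤s ())))))))) _

  cofactor-% : ∀ n .{{_ : NonZero n}} {m k s t} → m % n ≡ s → (k * m) % n ≡ t → ((k % n) * s) % n ≡ t
  cofactor-% n {m} {k} refl kmt = trans (sym (%-distribˡ-* k m n)) kmt

  -- Fermat descent: an even root x < m of x² ≡ −1 has a smaller cofactor, again ≡ 3 (mod 4).
  -1-nonresidue : ∀ m → m % 4 ≡ 3 → ∀ x → m ∤ x * x + 1
  -1-nonresidue = <-rec _ descend
    where
    descend : ∀ m → (∀ {k} → k < m → k % 4 ≡ 3 → ∀ x → k ∤ x * x + 1) → m % 4 ≡ 3 → ∀ x → m ∤ x * x + 1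
    descend m rec m≡3 x h with even-root {c = 1 + m / 4 * 2} m-odd x h
      where
      m-odd : m ≡ 1 + (1 + m / 4 * 2) * 2
      m-odd = trans (m≡m%n+[m/n]*n m 4) (trans (cong (_+ m / 4 * 4) m≡3)
        (solve 1 (λ q → con 3 :+ q :* con 4 := con 1 :+ (con 1 :+ q :* con 2) :* con 2) refl (m / 4)))
    ... | b , e<m , divides k eq =
      -- The cofactor k divides the same e² + 1, so e is again a root for the smaller modulus.
      rec (cofactor-< e<m 1<m eq)
        (inverse-3-mod-4 (k % 4) (m%n<n k 4) (cofactor-% 4 {m} {k} m≡3 km≡1))
        (b * 2) (divides m (trans eq (ℕ.*-comm k m)))
      where
      1<m : 1 < m
      1<m = ℕ.≤-trans (s≤s (s≤s z≤n)) (subst (_≤ m) m≡3 (m%n≤m m 4))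
      km≡1 : (k * m) % 4 ≡ 1
      km≡1 = trans (cong (_% 4) (trans (sym eq)
        (solve 1 (λ b → b :* con 2 :* (b :* con 2) :+ con 1 := con 1 :+ b :* b :* con 4) refl b)))
        ([m+kn]%n≡m%n 1 (b * b) 4)

  -- Odd squares are 1 (mod 8). An even root of x² ≡ -2 would make the cofactor even and take it out
  -- of the classes 5 and 7.
  odd-square-% : ∀ b → ((1 + b * 2) * (1 + b * 2) + 2) % 8 ≡ 3
  odd-square-% b with b divMod 2
  ... | result c zero refl = trans (cong (_% 8)
    (solve 1 (λ c → (con 1 :+ c :* con 2 :* con 2) :* (con 1 :+ c :* con 2 :* con 2) :+ con 2
                 := con 3 :+ (c :+ c :* c :* con 2) :* con 8) refl c))
    ([m+kn]%n≡m%n 3 (c + c * c * 2) 8)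
  ... | result c (suc zero) refl = trans (cong (_% 8)
    (solve 1 (λ c → (con 1 :+ (con 1 :+ c :* con 2) :* con 2) :* (con 1 :+ (con 1 :+ c :* con 2) :* con 2) :+ con 2
                 := con 3 :+ (con 1 :+ con 3 :* c :+ c :* c :* con 2) :* con 8) refl c))
    ([m+kn]%n≡m%n 3 (1 + 3 * c + c * c * 2) 8)

  -- The same descent with an odd root of x² ≡ −2: its cofactor alternates between 5 and 7 (mod 8).
  -2-nonresidue : ∀ m → m % 8 ≡ 5 ⊎ m % 8 ≡ 7 → ∀ x → m ∤ x * x + 2
  -2-nonresidue = <-rec _ descend
    where
    odd : ∀ m → m % 8 ≡ 5 ⊎ m % 8 ≡ 7 → ∃[ c ] m ≡ 1 + c * 2
    odd m (inj₁ m≡5) = 2 + m / 8 * 4 , trans (m≡m%n+[m/n]*n m 8) (trans (cong (_+ m / 8 * 8) m≡5)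
      (solve 1 (λ q → con 5 :+ q :* con 8 := con 1 :+ (con 2 :+ q :* con 4) :* con 2) refl (m / 8)))
    odd m (inj₂ m≡7) = 3 + m / 8 * 4 , trans (m≡m%n+[m/n]*n m 8) (trans (cong (_+ m / 8 * 8) m≡7)
      (solve 1 (λ q → con 7 :+ q :* con 8 := con 1 :+ (con 3 :+ q :* con 4) :* con 2) refl (m / 8)))
    2< : ∀ m → m % 8 ≡ 5 ⊎ m % 8 ≡ 7 → 2 < m
    2< m (inj₁ m≡5) = ℕ.≤-trans (s≤s (s≤s (s≤s z≤n))) (subst (_≤ m) m≡5 (m%n≤m m 8))
    2< m (inj₂ m≡7) = ℕ.≤-trans (s≤s (s≤s (s≤s z≤n))) (subst (_≤ m) m≡7 (m%n≤m m 8))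
    cofactor : ∀ m k → m % 8 ≡ 5 ⊎ m % 8 ≡ 7 → (k * m) % 8 ≡ 3 → k % 8 ≡ 5 ⊎ k % 8 ≡ 7
    cofactor m k (inj₁ m≡5) km≡3 = inj₂ (quotient-3/5-mod-8 (k % 8) (m%n<n k 8) (cofactor-% 8 {m} {k} m≡5 km≡3))
    cofactor m k (inj₂ m≡7) km≡3 = inj₁ (quotient-3/7-mod-8 (k % 8) (m%n<n k 8) (cofactor-% 8 {m} {k} m≡7 km≡3))
    descend : ∀ m → (∀ {k} → k < m → k % 8 ≡ 5 ⊎ k % 8 ≡ 7 → ∀ x → k ∤ x * x + 2) →
              m % 8 ≡ 5 ⊎ m % 8 ≡ 7 → ∀ x → m ∤ x * x + 2
    descend m rec m≡ x h with odd m m≡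
    ... | c , m-odd with odd-root {c = c} m-odd (λ m∣2 → ℕ.<⇒≱ (2< m m≡) (∣⇒≤ m∣2)) x h
    ...   | b , e<m , divides k eq =
      rec (cofactor-< e<m (2< m m≡) eq) (cofactor m k m≡ (trans (cong (_% 8) (sym eq)) (odd-square-% b)))
        (1 + b * 2) (divides m (trans eq (ℕ.*-comm k m)))

  -- Norms divisible by an inert prime

  prime-coprime : ∀ {p y} → Prime p → p ∤ y → Coprime p y
  prime-coprime pp p∤y (d∣p , d∣y) with prime⇒irreducible pp d∣p
  ... | inj₁ d≡1  = d≡1
  ... | inj₂ refl = contradiction d∣y p∤y

  -- Over the naturals Bézout gives ay ≡ 1 or ay ≡ -1 (mod p). Only (ay)² enters x² + dy², so either
  -- sign serves.
  square-inverse : ∀ {p y} → Coprime p y → ∃[ a ] ∃[ k ] ((a * y) * (a * y) ≡ 1 + k * p ⊎ p ∣ 1)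
  square-inverse {p} {y} c with coprime-Bézout c
  ... | Bézout.-+ b a eq = a , b * (2 + b * p) , inj₁ (trans (cong (λ t → t * t) (sym eq))
    (solve 2 (λ b p → (con 1 :+ b :* p) :* (con 1 :+ b :* p) := con 1 :+ b :* (con 2 :+ b :* p) :* p) refl b p))
  ... | Bézout.+- b a eq with a * y in ay
  -- With ay = 0 Bézout reads 1 = bp, which is the degenerate alternative.
  ...   | zero  = 0 , 0 , inj₂ (divides b eq)
  ...   | suc t = a , t * b , inj₁ (trans (cong (λ t → t * t) ay) (trans
    (solve 1 (λ t → (con 1 :+ t) :* (con 1 :+ t) := con 1 :+ t :* (con 2 :+ t)) refl t)
    (cong suc (trans (cong (t *_) eq) (sym (ℕ.*-assoc t b p))))))

  root-of-norm : ∀ {p d} x {y} → Coprime p y → p ∣ x * x + d * (y * y) → ∃[ z ] p ∣ z * z + d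
  root-of-norm {p} {d} x {y} c h with square-inverse c
  ... | a , k , inj₂ p∣1 = 0 , subst (p ∣_) (ℕ.*-identityˡ d) (∣m⇒∣m*n d p∣1)
  ... | a , k , inj₁ eq  = x * a , ∣m+n∣n⇒∣m
    (subst (p ∣_)
      (trans (solve 4 (λ x y a d → (x :* x :+ d :* (y :* y)) :* (a :* a)
                               := x :* a :* (x :* a) :+ d :* (a :* y :* (a :* y))) refl x y a d)
      (trans (cong (λ t → x * a * (x * a) + d * t) eq)
        (solve 5 (λ x a d k p → x :* a :* (x :* a) :+ d :* (con 1 :+ k :* p)
                             := x :* a :* (x :* a) :+ d :+ d :* k :* p) refl x a d k p)))
      (∣m⇒∣m*n (a * a) h))
    (n∣m*n (d * k))

  divides-both : ∀ {p d} → Prime p → (∀ z → p ∤ z * z + d) → ∀ x y → p ∣ x * x + d * (y * y) → p ∣ x × p ∣ y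
  divides-both {p} {d} pp nr x y h with p ∣? y
  ... | no  p∤y with z , p∣z²+d ← root-of-norm x (prime-coprime pp p∤y) h = contradiction p∣z²+d (nr z)
  ... | yes p∣y = [ id , id ] (euclidsLemma x x pp (∣m+n∣n⇒∣m h (∣n⇒∣m*n d (∣m⇒∣m*n y p∣y)))) , p∣y

  -- As -d is a nonresidue, p divides x and y together, so p² splits off the norm each time.
  -- Starting from an odd exponent, this ends with p dividing u.
  norm-odd-power : ∀ {p d} → Prime p → (∀ z → p ∤ z * z + d) → ∀ α {u} → p ∤ u →
                   ∀ x y → x * x + d * (y * y) ≢ p ^ suc (α * 2) * u
  norm-odd-power {p} {d} pp nr α {u} p∤u x y eq
    with divides-both pp nr x y (subst (p ∣_) (sym (trans eq (ℕ.*-assoc p _ u))) (m∣m*n _))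
  ... | divides x′ refl , divides y′ refl = step α (ℕ.*-cancelˡ-≡ _ _ p {{prime⇒nonZero pp}} (begin
      p * (p * (x′ * x′ + d * (y′ * y′)))
        ≡⟨ solve 4 (λ p d x y → p :* (p :* (x :* x :+ d :* (y :* y)))
                             := x :* p :* (x :* p) :+ d :* (y :* p :* (y :* p))) refl p d x′ y′ ⟩
      x′ * p * (x′ * p) + d * (y′ * p * (y′ * p)) ≡⟨ eq ⟩
      p ^ suc (α * 2) * u                         ≡⟨ ℕ.*-assoc p (p ^ (α * 2)) u ⟩
      p * (p ^ (α * 2) * u)                       ∎))
    where
    open ≡-Reasoning
    step : ∀ α → p * (x′ * x′ + d * (y′ * y′)) ≢ p ^ (α * 2) * u
    step zero    e = p∤u (subst (p ∣_) (trans e (ℕ.*-identityˡ u)) (m∣m*n _))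
    step (suc α) e = norm-odd-power pp nr α p∤u x′ y′
      (ℕ.*-cancelˡ-≡ _ _ p {{prime⇒nonZero pp}} (trans e (ℕ.*-assoc p _ u)))

  -- The number 8M + 1

  odd-power-% : ∀ p r → p % 8 ≡ 7 → (r * p) % 8 ≡ 1 → ∀ α → (r * p ^ suc (α * 2)) % 8 ≡ 1
  odd-power-% p r p≡7 rp≡1 zero    = trans (cong (λ t → (r * t) % 8) (ℕ.*-identityʳ p)) rp≡1
  odd-power-% p r p≡7 rp≡1 (suc α) = begin
    (r * (p * (p * P))) % 8
      ≡⟨ cong (_% 8) (solve 3 (λ r p P → r :* (p :* (p :* P)) := p :* p :* (r :* P)) refl r p P) ⟩
    (p * p * (r * P)) % 8                ≡⟨ %-distribˡ-* (p * p) (r * P) 8 ⟩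
    ((p * p) % 8 * ((r * P) % 8)) % 8    ≡⟨ cong₂ (λ s t → (s * t) % 8) p²≡1 (odd-power-% p r p≡7 rp≡1 α) ⟩
    1                                    ∎
    where
    open ≡-Reasoning
    P = p ^ suc (α * 2)
    p²≡1 : (p * p) % 8 ≡ 1
    p²≡1 = trans (%-distribˡ-* p p 8) (cong (λ s → (s * s) % 8) p≡7)

  -- The congruence makes the division by 8 exact. The cofactor r + 8pn is isolated because it is
  -- prime to p whenever r is.
  8*index+1 : ∀ p r n α → (r * p ^ suc (α * 2)) % 8 ≡ 1 →
    8 * (p ^ (suc α * 2) * n + (r * p ^ suc (α * 2) ∸ 1) / 8) + 1 ≡ p ^ suc (α * 2) * (r + 8 * p * n)
  8*index+1 p r n α R≡1 = begin
    8 * (p * P * n + (R ∸ 1) / 8) + 1 ≡⟨ cong (λ t → 8 * (p * P * n + t) + 1) R∸1/8 ⟩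
    8 * (p * P * n + t) + 1           ≡⟨ solve 4 (λ p P n t → con 8 :* (p :* P :* n :+ t) :+ con 1
                                                         := con 8 :* (p :* P :* n) :+ (con 1 :+ t :* con 8)) refl p P n t ⟩
    8 * (p * P * n) + (1 + t * 8)     ≡⟨ cong (8 * (p * P * n) +_) (sym R≡) ⟩
    8 * (p * P * n) + r * P           ≡⟨ solve 4 (λ p P n r → con 8 :* (p :* P :* n) :+ r :* P
                                                         := P :* (r :+ con 8 :* p :* n)) refl p P n r ⟩
    P * (r + 8 * p * n)               ∎
    where
    open ≡-Reasoning
    P = p ^ suc (α * 2)
    R = r * P
    t = R / 8
    R≡ : R ≡ 1 + t * 8
    R≡ = trans (m≡m%n+[m/n]*n R 8) (cong (_+ t * 8) R≡1)
    R∸1/8 : (R ∸ 1) / 8 ≡ t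
    R∸1/8 = trans (cong (λ s → (s ∸ 1) / 8) R≡) (m*n/n≡m t 8)

  -- Exponents of the theta series

  IsSquare : ℕ → Set
  IsSquare n = ∃[ y ] n ≡ y * y

  IsTriangular : ℕ → Set
  IsTriangular n = ∃[ x ] 8 * n + 1 ≡ x * x

  RepresentedBy : ℕ → ℕ → Set
  RepresentedBy d n = ∃[ x ] ∃[ y ] x * x + d * (y * y) ≡ 8 * n + 1

  -- These are the triangular numbers with indices k = 2n + 1 and k = 2n + 2; the witnesses are 2k +
  -- 1.
  ψ-exponent-triangular : ∀ n i j → i ≡ suc n * suc (n * 2) → j ≡ 0 ⊎ j ≡ suc n * 2 → IsTriangular (i + j)
  ψ-exponent-triangular n i j refl (inj₁ refl) = 3 + 4 * n ,
    solve 1 (λ n → con 8 :* ((con 1 :+ n) :* (con 1 :+ n :* con 2) :+ con 0) :+ con 1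
                := (con 3 :+ con 4 :* n) :* (con 3 :+ con 4 :* n)) refl n
  ψ-exponent-triangular n i j refl (inj₂ refl) = 5 + 4 * n ,
    solve 1 (λ n → con 8 :* ((con 1 :+ n) :* (con 1 :+ n :* con 2) :+ (con 1 :+ n) :* con 2) :+ con 1
                := (con 5 :+ con 4 :* n) :* (con 5 :+ con 4 :* n)) refl n

  triangular+square : ∀ i j → IsTriangular i → IsSquare j → RepresentedBy 2 (i + j)
  triangular+square i _ (x , eq) (y , refl) = x , 2 * y ,
    trans (cong (_+ 2 * (2 * y * (2 * y))) (sym eq))
      (solve 2 (λ i y → con 8 :* i :+ con 1 :+ con 2 :* (con 2 :* y :* (con 2 :* y))
                     := con 8 :* (i :+ y :* y) :+ con 1) refl i y)

  triangular+2square : ∀ i j → IsTriangular i → IsSquare j → RepresentedBy 1 (i + (j + j))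
  triangular+2square i _ (x , eq) (y , refl) = x , 4 * y ,
    trans (cong (_+ 1 * (4 * y * (4 * y))) (sym eq))
      (solve 2 (λ i y → con 8 :* i :+ con 1 :+ con 1 :* (con 4 :* y :* (con 4 :* y))
                     := con 8 :* (i :+ (y :* y :+ y :* y)) :+ con 1) refl i y)

-- Coefficients modulo 8

-- A disjunction, so that a nonzero coefficient hands over the witness of a representation without
-- any decision procedure for P.
SupportedOn : (ℕ → Set) → Series → Set
SupportedOn P f = ∀ n → f n ≡ 0ℤ ⊎ P n

supported-map : ∀ {P Q f} → (∀ {n} → P n → Q n) → SupportedOn P f → SupportedOn Q f
supported-map P⇒Q supp n = [ inj₁ , inj₂ ∘ P⇒Q ]′ (supp n)

zero-sum : ∀ {A : Set} {x y} → x ≡ 0ℤ ⊎ A → y ≡ 0ℤ ⊎ A → x ℤ.+ y ≡ 0ℤ ⊎ A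
zero-sum (inj₁ refl) (inj₁ refl) = inj₁ refl
zero-sum (inj₁ _)    (inj₂ a)    = inj₂ a
zero-sum (inj₂ a)    _           = inj₂ a

supported-⊕ : ∀ {P f g} → SupportedOn P f → SupportedOn P g → SupportedOn P (f ⊕ g)
supported-⊕ supp-f supp-g n = zero-sum (supp-f n) (supp-g n)

supported-⊖ : ∀ {P f} → SupportedOn P f → SupportedOn P (⊖ f)
supported-⊖ supp n = [ (λ eq → inj₁ (cong ℤ.-_ eq)) , inj₂ ]′ (supp n)

supported-⊛ : ∀ {P Q R f g} → (∀ i j → P i → Q j → R (i + j)) →
              SupportedOn P f → SupportedOn Q g → SupportedOn R (f ⊛ g)
supported-⊛ {R = R} {f} {g} P+Q⇒R supp-f supp-g n = ⊛-closed (λ z → z ≡ 0ℤ ⊎ R n) zero-sum n term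
  where
  term : ∀ i j → i + j ≡ n → f i ℤ.* g j ≡ 0ℤ ⊎ R n
  term i j refl with supp-f i | supp-g j
  ... | inj₁ fi≡0 | _         = inj₁ (trans (cong (ℤ._* g j) fi≡0) (ℤ.*-zeroˡ (g j)))
  ... | inj₂ _    | inj₁ gj≡0 = inj₁ (trans (cong (ℤ._*_ (f i)) gj≡0) (ℤ.*-zeroʳ (f i)))
  ... | inj₂ p    | inj₂ q    = inj₂ (P+Q⇒R i j p q)

supported-const : ∀ c → SupportedOn (_≡ 0) (const c)
supported-const c zero    = inj₂ refl
supported-const c (suc n) = inj₁ refl

supported-X : SupportedOn (_≡ 1) X
supported-X zero          = inj₁ refl
supported-X (suc zero)    = inj₂ refl
supported-X (suc (suc n)) = inj₁ refl

-- In a square, f i · f j and f j · f i pair up; only a middle term f(m)² with 2m = n stays single.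
-- Peeling one coefficient off each end lowers n by 2, hence the recursion on `tail f`.
square-even : ∀ {P} f → SupportedOn P f → ∀ n → ℤ.+ 2 ℤ.∣ (f ⊛ f) n ⊎ ∃[ m ] (m + m ≡ n × P m)
square-even f supp zero with supp 0
... | inj₁ f₀≡0 = inj₁ (ℤ.divides 0ℤ (trans (cong (ℤ._* f 0) f₀≡0) (ℤ.*-zeroˡ (f 0))))
... | inj₂ p    = inj₂ (0 , refl , p)
square-even f supp (suc zero) = inj₁ (ℤ.divides (f 0 ℤ.* f 1)
  (solve 2 (λ a b → a :* b :+ b :* a := a :* b :* con (ℤ.+ 2)) refl (f 0) (f 1)))
  where open ℤ-Solver
square-even f supp (suc (suc n)) with square-even (tail f) (supp ∘ suc) n
... | inj₂ (m , refl , p) = inj₂ (suc m , cong suc (ℕ.+-suc m m) , p)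
... | inj₁ (ℤ.divides k eq) = inj₁ (ℤ.divides (f 0 ℤ.* f (suc (suc n)) ℤ.+ k) (begin
  f 0 ℤ.* f (suc (suc n)) ℤ.+ (tail f ⊛ f) (suc n)
    ≡⟨ cong (ℤ._+_ (f 0 ℤ.* f (suc (suc n)))) (⊛-suc (tail f) f n) ⟩
  f 0 ℤ.* f (suc (suc n)) ℤ.+ ((tail f ⊛ tail f) n ℤ.+ f (suc (suc n)) ℤ.* f 0)
    ≡⟨ cong (λ s → f 0 ℤ.* f (suc (suc n)) ℤ.+ (s ℤ.+ f (suc (suc n)) ℤ.* f 0)) eq ⟩
  f 0 ℤ.* f (suc (suc n)) ℤ.+ (k ℤ.* ℤ.+ 2 ℤ.+ f (suc (suc n)) ℤ.* f 0)
    ≡⟨ solve 3 (λ a b k → a :* b :+ (k :* con (ℤ.+ 2) :+ b :* a) := (a :* b :+ k) :* con (ℤ.+ 2)) refl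
         (f 0) (f (suc (suc n))) k ⟩
  (f 0 ℤ.* f (suc (suc n)) ℤ.+ k) ℤ.* ℤ.+ 2 ∎))
  where
  open ≡-Reasoning
  open ℤ-Solver

-- Expansion of the series of ped at degree N

module _ (N : ℕ) where

  open Truncated N using (seriesRing; const-homomorphism; agree; pointwise; at)
  open ThetaSums seriesRing const-homomorphism hiding (_⊕_; _⊛_; ⊖_)

  supported-⋆ : ∀ {k f} m → SupportedOn (_≡ k) f → SupportedOn (_≡ m * k) (f ⋆ m)
  supported-⋆ zero    supp = supported-const 1ℤ
  supported-⋆ (suc m) supp = supported-⊛ (λ i j → cong₂ _+_) supp (supported-⋆ m supp)

  φ-tail-support : ∀ n → SupportedOn IsSquare (φ-tail X n)
  φ-tail-support zero    _ = inj₁ refl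
  φ-tail-support (suc n) = supported-⊕ (φ-tail-support n)
    (supported-map (λ i≡ → suc n , trans i≡ (cong (λ k → suc n * suc k) (ℕ.*-identityʳ n)))
      (supported-⋆ (suc n) (supported-⊛ (λ i j → cong₂ _+_) (supported-⊖ supported-X) (supported-⋆ n supported-X))))

  supported-X² : SupportedOn (_≡ 2) (X ⊛ X)
  supported-X² = supported-⊛ (λ i j → cong₂ _+_) supported-X supported-X

  ψ-sum-support : ∀ n → SupportedOn IsTriangular (ψ-sum X n)
  ψ-sum-support zero    = supported-map (λ { refl → 1 , refl }) (supported-const 1ℤ)
  ψ-sum-support (suc n) = supported-⊕ (ψ-sum-support n)
    (supported-⊛ {P = _≡ suc n * suc (n * 2)} {Q = λ j → j ≡ 0 ⊎ j ≡ suc n * 2} (ψ-exponent-triangular n)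
      (supported-⋆ (suc n) (supported-⊛ (λ i j → cong₂ _+_) (supported-⊖ supported-X) (supported-⋆ n supported-X²)))
      (supported-⊕ (supported-map inj₁ (supported-const 1ℤ)) (supported-map inj₂ (supported-⋆ (suc n) supported-X²))))

  X⋆-shift : ∀ m f n → (X ⋆ m ⊛ f) n ≡ shift m f n
  X⋆-shift zero    f n       = trans (const-⊛ 1ℤ f n) (ℤ.*-identityˡ (f n))
  X⋆-shift (suc m) f zero    = trans (cong (ℤ._* f 0) (ℤ.*-zeroˡ ((X ⋆ m) 0))) (ℤ.*-zeroˡ (f 0))
  X⋆-shift (suc m) f (suc n) = trans (⊛-assoc X (X ⋆ m) f (suc n)) (trans (X-⊛ (X ⋆ m ⊛ f) n) (X⋆-shift m f n))

  X⋆-vanishes : ∀ {m} → N < m → X ⋆ m ≈ 𝟎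
  X⋆-vanishes {m} N<m = agree λ i i≤N → [ id , (λ i≡m → contradiction
    (subst (_≤ N) (trans i≡m (ℕ.*-identityʳ m)) i≤N) (ℕ.<⇒≱ N<m)) ]′ (supported-⋆ m supported-X i)

  pedSeries-step : ∀ k → pedSeries (suc k) ≈ pedSeries k ⊕ X ⋆ suc k ⊛ pedSeries (bound-after k)
  pedSeries-step k = pointwise λ n → trans (pedSeries-suc k n)
    (cong (ℤ._+_ (pedSeries k n)) (sym (X⋆-shift (suc k) (pedSeries (bound-after k)) n)))

  pedSeries-odd : ∀ n → (𝟏 ⊝ X ⋆ suc (n * 2)) ⊛ pedSeries (suc (n * 2)) ≈ pedSeries (n * 2)
  pedSeries-odd n = cancel-difference {k = 𝟏}
    (subst (λ b → g′ ≈ g ⊕ x ⊛ pedSeries b)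
      (bound-after-odd λ { (divides k eq) →
        ℕ.even≢odd k n (trans (ℕ.*-comm 2 k) (trans (sym eq) (cong suc (ℕ.*-comm n 2)))) })
      (pedSeries-step (n * 2)))
    (solve 3 (λ x g g′ → (one :- x) :* g′ := g :+ one :* (g′ :- (g :+ x :* g′))) ≈-refl x g g′)
    where
    x  = X ⋆ suc (n * 2)
    g  = pedSeries (n * 2)
    g′ = pedSeries (suc (n * 2))

  pedSeries-even : ∀ n → pedSeries (suc n * 2) ≈ (𝟏 ⊕ X ⋆ (suc n * 2)) ⊛ pedSeries (suc (n * 2))
  pedSeries-even n = ≈-trans
    (subst (λ b → pedSeries (suc n * 2) ≈ g ⊕ x ⊛ pedSeries b) (bound-after-even (divides (suc n) refl))
      (pedSeries-step (suc (n * 2))))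
    (solve 2 (λ x g → g :+ x :* g := (one :+ x) :* g) ≈-refl x g)
    where
    x = X ⋆ (suc n * 2)
    g = pedSeries (suc (n * 2))

  open PedProduct X pedSeries (pointwise pedSeries-zero) pedSeries-odd pedSeries-even using (ped-φ≈ψ)

  private
    -- The bound 2N is even, as `ped-φ≈ψ` requires; it is at least N, so F agrees with ped up to
    -- degree N, and X²ᴺ⁺¹ vanishes.
    F = pedSeries (N * 2)
    S = φ-tail X (N * 2)
    Ψ = ψ-sum X N

  -- Multiply F(1 + 2S) = Ψ by 1 - 2S + 4S² and use (1 + 2S)(1 - 2S + 4S²) = 1 + 8S³. Leaving F in
  -- the remainder gives an exact identity over ℤ, without inverting 1 + 2S or passing to
  -- coefficients modulo 8.
  ped-expansion : F ≈ Ψ ⊕ const (ℤ.- ℤ.+ 2) ⊛ (Ψ ⊛ S) ⊕ const (ℤ.+ 4) ⊛ (Ψ ⊛ (S ⊛ S))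
                      ⊕ const (ℤ.- ℤ.+ 8) ⊛ (S ⊛ S ⊛ S ⊛ F)
  ped-expansion = cancel-difference {k = 𝟏 ⊕ const (ℤ.- ℤ.+ 2) ⊛ S ⊕ const (ℤ.+ 4) ⊛ (S ⊛ S)}
    (ped-φ≈ψ N (X⋆-vanishes (s≤s (ℕ.m≤m*n N 2))))
    (solve 3 (λ F S Ψ → F := Ψ :+ con (ℤ.- ℤ.+ 2) :* (Ψ :* S) :+ con (ℤ.+ 4) :* (Ψ :* (S :* S))
                        :+ con (ℤ.- ℤ.+ 8) :* (S :* S :* S :* F)
                        :+ (one :+ con (ℤ.- ℤ.+ 2) :* S :+ con (ℤ.+ 4) :* (S :* S))
                           :* (F :* (one :+ (S :+ S)) :- Ψ)) ≈-refl F S Ψ)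

  -- Of the four terms of `ped-expansion` at degree N, the first two vanish, the third is 4 times an
  -- even number, and the last has the factor 8. A nonzero Ψ N would give the representation x² +
  -- 0².
  8∣ped : ¬ RepresentedBy 1 N → ¬ RepresentedBy 2 N → 8 ∣ ped N
  8∣ped no-rep₁ no-rep₂ = ℤ.∣⇒∣ᵤ (subst (ℤ.+ 8 ℤ.∣_)
    (trans (sym (at ped-expansion N ℕ.≤-refl)) (ped-coefficient (N * 2) N (ℕ.m≤m*n N 2)))
    (ℤ.∣m∣n⇒∣m+n (ℤ.∣m∣n⇒∣m+n (ℤ.∣m∣n⇒∣m+n
      (8∣0 Ψ≡0)
      (8∣0 (trans (const-⊛ _ (Ψ ⊛ S) N) (cong (ℤ._*_ (ℤ.- ℤ.+ 2)) Ψ⊛S≡0))))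
      (subst (ℤ.+ 8 ℤ.∣_) (sym (const-⊛ _ (Ψ ⊛ (S ⊛ S)) N)) (ℤ.*-monoʳ-∣ (ℤ.+ 4) Ψ⊛S²-even)))
      (subst (ℤ.+ 8 ℤ.∣_) (sym (const-⊛ _ (S ⊛ S ⊛ S ⊛ F) N))
        (ℤ.∣m⇒∣m*n ((S ⊛ S ⊛ S ⊛ F) N) (ℤ.divides (ℤ.- 1ℤ) refl)))))
    where
    8∣0 : ∀ {z} → z ≡ 0ℤ → ℤ.+ 8 ℤ.∣ z
    8∣0 refl = ℤ.divides 0ℤ refl
    Ψ≡0 : Ψ N ≡ 0ℤ
    Ψ≡0 = [ id , (λ { (x , eq) → contradiction (x , 0 , trans (ℕ.+-identityʳ (x * x)) (sym eq)) no-rep₁ }) ]′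
      (ψ-sum-support N N)
    Ψ⊛S≡0 : (Ψ ⊛ S) N ≡ 0ℤ
    Ψ⊛S≡0 = [ id , (λ rep → contradiction rep no-rep₂) ]′
      (supported-⊛ {R = RepresentedBy 2} triangular+square
        (ψ-sum-support N) (φ-tail-support (N * 2)) N)
    Ψ⊛S²-even : ℤ.+ 2 ℤ.∣ (Ψ ⊛ (S ⊛ S)) N
    Ψ⊛S²-even = ⊛-closed (ℤ.+ 2 ℤ.∣_) ℤ.∣m∣n⇒∣m+n N term
      where
      term : ∀ i j → i + j ≡ N → ℤ.+ 2 ℤ.∣ Ψ i ℤ.* (S ⊛ S) j
      term i j i+j≡N with ψ-sum-support N i | square-even S (φ-tail-support (N * 2)) j
      ... | inj₁ Ψi≡0 | _       = ℤ.∣m⇒∣m*n ((S ⊛ S) j) (ℤ.divides 0ℤ Ψi≡0)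
      ... | inj₂ _    | inj₁ 2∣ = ℤ.∣n⇒∣m*n (Ψ i) 2∣
      ... | inj₂ tri  | inj₂ (m , refl , sq) =
        contradiction (subst (RepresentedBy 1) i+j≡N (triangular+2square i m tri sq)) no-rep₁

theorem1p2 : (p : ℕ) → Prime p → p % 8 ≡ 7 →
    (r : ℕ) → 1 ≤ r → r < 8 * p → (r * p) % 8 ≡ 1 → gcd r p ≡ 1 →
    (n α : ℕ) →
    ped (p ^ (2 * α + 2) * n + (r * p ^ (2 * α + 1) ∸ 1) / 8) % 8 ≡ 0
theorem1p2 p pp p≡7 r _ _ rp≡1 coprime n α = subst₂
  -- The proof runs with the exponents `suc α * 2` and `suc (α * 2)`, which unfold to two further
  -- factors p when α increases by 1.
  (λ e e′ → ped (p ^ e * n + (r * p ^ e′ ∸ 1) / 8) % 8 ≡ 0)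
  (trans (ℕ.+-comm 2 (α * 2)) (cong (_+ 2) (ℕ.*-comm α 2)))
  (trans (ℕ.+-comm 1 (α * 2)) (cong (_+ 1) (ℕ.*-comm α 2)))
  (n∣m⇒m%n≡0 _ 8 (8∣ped M (no-rep (-1-nonresidue p p≡3)) (no-rep (-2-nonresidue p (inj₂ p≡7)))))
  where
  M = p ^ (suc α * 2) * n + (r * p ^ suc (α * 2) ∸ 1) / 8
  p≡3 : p % 4 ≡ 3
  p≡3 = trans (cong (_% 4) (trans (m≡m%n+[m/n]*n p 8) (trans (cong (_+ p / 8 * 8) p≡7)
      (solve 1 (λ q → con 7 :+ q :* con 8 := con 3 :+ (con 1 :+ q :* con 2) :* con 4) refl (p / 8)))))
    ([m+kn]%n≡m%n 3 (1 + p / 8 * 2) 4)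
    where open ℕ-Solver
  p∤u : p ∤ r + 8 * p * n
  -- Since p divides 8pn, it would divide r and thus gcd(r, p) = 1, whereas p ≡ 7 (mod 8) forces p ≥
  -- 7.
  p∤u p∣u = contradiction (∣⇒≤ (subst (p ∣_) coprime (gcd-greatest p∣r (divides 1 (sym (ℕ.*-identityˡ p))))))
    (ℕ.<⇒≱ (ℕ.≤-trans (s≤s (s≤s z≤n)) (subst (_≤ p) p≡7 (m%n≤m p 8))))
    where
    p∣r : p ∣ r
    p∣r = ∣m+n∣n⇒∣m p∣u (∣m⇒∣m*n n (n∣m*n 8))
  no-rep : ∀ {d} → (∀ z → p ∤ z * z + d) → ¬ RepresentedBy d M
  no-rep nonresidue (x , y , eq) = norm-odd-power pp nonresidue α p∤u x y
    (trans eq (8*index+1 p r n α (odd-power-% p r p≡7 rp≡1 α)))
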